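{- There is a strict linear order $\prec$ on $\mathbb{N}$ such that $\mathrm{FO}(<,\prec)$ has the same expressive power as $\mathrm{FO}(\mathrm{Bit})$ on the class of all finite structures.
   Context: $\mathbb{N}=\{0,1,2,\dots\}$ and $[n]=\{0,\dots,n\}$ for $n\in\mathbb{N}$. A $k$-ary numerical predicate is a relation $P\subseteq\mathbb{N}^k$; it induces the built-in predicate $(P^n)_{n\in\mathbb{N}}$ with $P^n=P\cap[n]^k$. For a list $\ell$ of such predicates, $\mathrm{FO}(\ell)$ is first-order logic over finite structures whose universe is $[n]$ for some $n$, in which each predicate symbol from $\ell$ is interpreted by its restriction $P^n$ (in addition to the structure's own relations). Two such logics have the same expressive power if every sentence of either is equivalent, on all these finite structures, to a sentence of the other. $<$ is the usual order on $\mathbb{N}$, and $\mathrm{Bit}=\{(a,i)\in\mathbb{N}^2 : 2\nmid\lfloor a/2^i\rfloor\}$, i.e. the $i$-th bit of the binary representation of $a$ is $1$. -}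

module Defs where

open import Level using (0ℓ)
open import Data.Nat using (ℕ; zero; suc; _^_; _<_)
open import Data.Nat.DivMod using (_/_)
open import Data.Nat.Divisibility using (_∣_)
open import Data.Nat.Properties using (m^n≢0)
open import Data.Fin using (Fin; toℕ; zero; suc)
open import Data.List using (List; length; lookup; []; _∷_)
open import Data.Vec using (Vec; map)
open import Data.Product using (Σ; _×_; _,_)
open import Data.Sum using (_⊎_)
open import Relation.Nullary using (¬_)
open import Relation.Binary.PropositionalEquality using (_≡_)
open import Function.Bundles using (_⇔_)

Bit : ℕ → ℕ → Set
Bit a i = ¬ (2 ∣ (_/_ a (2 ^ i) {{m^n≢0 2 i}}))

NumPred : ℕ → Set₁
NumPred k = Vec ℕ k → Set

BuiltIns : List ℕ → Set₁
BuiltIns τ = (j : Fin (length τ)) → NumPred (lookup τ j)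

binary : (ℕ → ℕ → Set) → NumPred 2
binary R (a Vec.∷ b Vec.∷ Vec.[]) = R a b

-- First-order logic FO(ℓ) over finite relational structures.
-- σ : arities of the structure's own relation symbols
-- τ : arities of the built-in predicate symbols
-- m : number of free variables (de Bruijn, Fin m)

data Formula (σ τ : List ℕ) (m : ℕ) : Set where
  eq   : Fin m → Fin m → Formula σ τ m
  rel  : (i : Fin (length σ)) → Vec (Fin m) (lookup σ i) → Formula σ τ m
  bip  : (j : Fin (length τ)) → Vec (Fin m) (lookup τ j) → Formula σ τ m
  neg  : Formula σ τ m → Formula σ τ m
  and  : Formula σ τ m → Formula σ τ m → Formula σ τ m
  or   : Formula σ τ m → Formula σ τ m → Formula σ τ m
  ex   : Formula σ τ (suc m) → Formula σ τ m
  all  : Formula σ τ (suc m) → Formula σ τ m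

Sentence : List ℕ → List ℕ → Set
Sentence σ τ = Formula σ τ 0

-- A finite σ-structure with universe [n] = {0,…,n}, represented by Fin (suc n).
Structure : List ℕ → ℕ → Set₁
Structure σ n = (i : Fin (length σ)) → Vec (Fin (suc n)) (lookup σ i) → Set

extend : ∀ {m n} → Fin (suc n) → (Fin m → Fin (suc n)) → Fin (suc m) → Fin (suc n)
extend a ρ zero    = a
extend a ρ (suc x) = ρ x

-- Satisfaction.  A built-in symbol j is interpreted by P_j^n = P_j ∩ [n]^k,
-- i.e. P_j evaluated on the (numerical values of the) elements of [n].
Sat : ∀ {σ τ m} → BuiltIns τ → (n : ℕ) → Structure σ n →
      (Fin m → Fin (suc n)) → Formula σ τ m → Set
Sat I n A ρ (eq x y)   = ρ x ≡ ρ y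
Sat I n A ρ (rel i xs) = A i (map ρ xs)
Sat I n A ρ (bip j xs) = I j (map (λ x → toℕ (ρ x)) xs)
Sat I n A ρ (neg φ)    = ¬ Sat I n A ρ φ
Sat I n A ρ (and φ ψ)  = Sat I n A ρ φ × Sat I n A ρ ψ
Sat I n A ρ (or φ ψ)   = Sat I n A ρ φ ⊎ Sat I n A ρ ψ
Sat I n A ρ (ex φ)     = Σ (Fin (suc n)) λ a → Sat I n A (extend a ρ) φ
Sat I n A ρ (all φ)    = (a : Fin (suc n)) → Sat I n A (extend a ρ) φ

empty : ∀ {n} → Fin 0 → Fin (suc n)
empty ()

Models : ∀ {σ τ} → BuiltIns τ → (n : ℕ) → Structure σ n → Sentence σ τ → Set
Models I n A φ = Sat I n A empty φ

AtMostAsExpressive : ∀ {τ₁ τ₂} → BuiltIns τ₁ → BuiltIns τ₂ → Set₁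
AtMostAsExpressive {τ₁} {τ₂} I₁ I₂ =
  (σ : List ℕ) (φ : Sentence σ τ₁) →
  Σ (Sentence σ τ₂) λ ψ →
    (n : ℕ) (A : Structure σ n) → Models I₁ n A φ ⇔ Models I₂ n A ψ

SameExpressivePower : ∀ {τ₁ τ₂} → BuiltIns τ₁ → BuiltIns τ₂ → Set₁
SameExpressivePower {τ₁} {τ₂} I₁ I₂ =
  AtMostAsExpressive {τ₁} {τ₂} I₁ I₂ × AtMostAsExpressive {τ₂} {τ₁} I₂ I₁

LtPrec : (ℕ → ℕ → Set) → BuiltIns (2 ∷ 2 ∷ [])
LtPrec _≺_ zero       = binary _<_
LtPrec _≺_ (suc zero) = binary _≺_

BitOnly : BuiltIns (2 ∷ [])
BitOnly zero = binary Bit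

{-# OPTIONS --safe #-}
module Submission where

-- Order ℕ by the exponent of 2 in x, ties broken by <, after putting first 0 and the tags
-- i ∪ {i} (numbers read as sets of bits) of the odd i. Powers of 2 are the p > 0 with
-- p < y whenever p ≺ y, so < and ≺ define divisibility by a power of 2, hence the bit of a at
-- a given power; the tag of i links i to 2^i. Conversely, Bit defines < because a < b is
-- decided by the largest bit in which a and b differ: an order on the bit positions lifts to
-- an order on exponentially larger numbers. An order on the numbers below about log log n is
-- coded by a single number in [n], recognised as a fixed point of this lifting, and three
-- liftings reach n.

open import Defs
open import Data.Empty using (⊥-elim)
open import Data.Fin using (Fin; zero; suc; toℕ; fromℕ<)
open import Data.Fin.Properties using (toℕ<n; toℕ-fromℕ<; toℕ-injective; any?; all?) renaming (_≟_ to _≟ᶠ_)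
open import Data.List using (List; []; _∷_; lookup; length)
open import Data.Nat
open import Data.Nat.DivMod
open import Data.Nat.Divisibility
open import Data.Nat.Properties
open import Data.Product using (Σ; ∃; _×_; _,_; proj₁; proj₂)
open import Data.Product.Function.NonDependent.Propositional using (_×-⇔_)
open import Data.Sum using (_⊎_; inj₁; inj₂; [_,_]′)
open import Data.Sum.Function.Propositional using (_⊎-⇔_)
open import Data.Vec as Vec using (Vec; []; _∷_)
open import Function using (_∘_; id)
open import Function.Bundles using (_⇔_; mk⇔; Equivalence)
open import Function.Properties.Equivalence using () renaming (refl to ⇔-refl; sym to ⇔-sym; trans to ⇔-trans)
open import Function.Related.TypeIsomorphisms using (¬-cong-⇔)
open import Relation.Binary.Definitions using (Trichotomous; tri<; tri≈; tri>)
open import Relation.Binary.PropositionalEquality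
open import Relation.Binary.Structures using (IsStrictTotalOrder)
open import Relation.Nullary
open import Relation.Nullary.Decidable using (_⊎-dec_; _×-dec_; ¬?; toSum; decidable-stable)
open import Relation.Unary using (Decidable)

open Equivalence using (to; from)

-- Bits

-- Divisibility by powers of 2 gives the bit of `a` at the number 2^i, but `Bit` names that position
-- by the number i; the missing link is the graph of exponentiation. A tag supplies it because its
-- bits can be compared with those of i at powers alone. Tags must be visible in the order without
-- spoiling divisibility: all of them are odd, so moving them to the front changes no comparison
-- with a power of 2 other than 1, and divisibility by 1 is trivial. In the other direction the
-- obstacle is circularity: comparing numbers needs an order on bit positions, which are again
-- numbers. Each lifting gains one exponential, so a fixed number of liftings must start from an
-- order whose length grows with n. A guessed code supplies it; being a set of nested sets, it needs
-- no pairing function. The code for the numbers below M is less than 2^2^M, so M is taken with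
-- 2^2^M ≤ n + 1 < 2^2^(M+1). Two liftings reach only 2^2^M, possibly about the square root of n;
-- since M + 1 ≤ 2^M, a third suffices.

data Halving : ℕ → Set where
  double   : ∀ q → Halving (q * 2)
  double+1 : ∀ q → Halving (1 + q * 2)

halving : ∀ a → Halving a
halving a with a divMod 2
... | result q zero refl       = double q
... | result q (suc zero) refl = double+1 q

2∤1 : ¬ 2 ∣ 1
2∤1 2∣1 with ∣⇒≤ 2∣1
... | s≤s ()

2∤1+double : ∀ q → ¬ 2 ∣ 1 + q * 2
2∤1+double q d = 2∤1 (∣m+n∣m⇒∣n (subst (2 ∣_) (+-comm 1 (q * 2)) d) (n∣m*n q))

Bit-zero : ∀ a → Bit a 0 ⇔ (¬ 2 ∣ a)
Bit-zero a = mk⇔ (subst (λ z → ¬ 2 ∣ z) (n/1≡n a)) (subst (λ z → ¬ 2 ∣ z) (sym (n/1≡n a)))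

¬Bit-zero-double : ∀ q → ¬ Bit (q * 2) 0
¬Bit-zero-double q b = to (Bit-zero _) b (n∣m*n q)

Bit-zero-double+1 : ∀ q → Bit (1 + q * 2) 0
Bit-zero-double+1 q = from (Bit-zero _) (2∤1+double q)

Bit-suc : ∀ a {q} i → a / 2 ≡ q → Bit a (suc i) ≡ Bit q i
Bit-suc a i refl = cong (λ z → ¬ 2 ∣ z) (sym (m/n/o≡m/[n*o] a 2 (2 ^ i) {{_}} {{m^n≢0 2 i}} {{m^n≢0 2 (suc i)}}))

Bit-suc-double : ∀ q i → Bit (q * 2) (suc i) ≡ Bit q i
Bit-suc-double q i = Bit-suc (q * 2) i (m*n/n≡m q 2)

Bit-suc-double+1 : ∀ q i → Bit (1 + q * 2) (suc i) ≡ Bit q i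
Bit-suc-double+1 q i =
  Bit-suc (1 + q * 2) i (trans (+-distrib-/-∣ʳ 1 (n∣m*n q {2})) (m*n/n≡m q 2))

Bit? : ∀ a i → Dec (Bit a i)
Bit? a i = ¬? (2 ∣? _/_ a (2 ^ i) {{m^n≢0 2 i}})

Bit⇒2^≤ : ∀ a i → Bit a i → 2 ^ i ≤ a
Bit⇒2^≤ a i b with 2 ^ i ≤? a
... | yes p = p
... | no ¬p = ⊥-elim (b (subst (2 ∣_) (sym (m<n⇒m/n≡0 {a} {2 ^ i} {{m^n≢0 2 i}} (≰⇒> ¬p))) (2 ∣0)))

n<2^n : ∀ n → n < 2 ^ n
n<2^n zero    = s≤s z≤n
n<2^n (suc n) = begin-strict
  suc n           <⟨ s≤s (n<2^n n) ⟩
  1 + 2 ^ n       ≤⟨ +-monoˡ-≤ (2 ^ n) (m^n>0 2 n) ⟩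
  2 ^ n + 2 ^ n   ≡⟨ cong (2 ^ n +_) (sym (+-identityʳ _)) ⟩
  2 ^ suc n       ∎
  where open ≤-Reasoning

2^-mono-≤ : ∀ {i j} → i ≤ j → 2 ^ i ≤ 2 ^ j
2^-mono-≤ = ^-monoʳ-≤ 2

2^-mono-< : ∀ {i j} → i < j → 2 ^ i < 2 ^ j
2^-mono-< = ^-monoʳ-< 2 (s≤s (s≤s z≤n))

2^-cancel-< : ∀ {i j} → 2 ^ i < 2 ^ j → i < j
2^-cancel-< lt = ≰⇒> λ j≤i → <⇒≱ lt (2^-mono-≤ j≤i)

2^-injective : ∀ {i j} → 2 ^ i ≡ 2 ^ j → i ≡ j
2^-injective e = ≤-antisym (≮⇒≥ λ lt → <-irrefl (sym e) (2^-mono-< lt))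
                           (≮⇒≥ λ lt → <-irrefl e (2^-mono-< lt))

Bit⇒< : ∀ a i → Bit a i → i < a
Bit⇒< a i b = <-≤-trans (n<2^n i) (Bit⇒2^≤ a i b)

double-cancel-< : ∀ {q} k → q * 2 < 2 ^ suc k → q < 2 ^ k
double-cancel-< {q} k lt = *-cancelʳ-< 2 q (2 ^ k) (subst (q * 2 <_) (*-comm 2 (2 ^ k)) lt)

double+1-cancel-< : ∀ {q} k → 1 + q * 2 < 2 ^ suc k → q < 2 ^ k
double+1-cancel-< {q} k lt = double-cancel-< k (<-trans (n<1+n (q * 2)) lt)

same-bits⇒≡ : ∀ k {a b} → a < 2 ^ k → b < 2 ^ k → (∀ i → Bit a i ⇔ Bit b i) → a ≡ b
same-bits⇒≡ zero (s≤s z≤n) (s≤s z≤n) _ = refl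
same-bits⇒≡ (suc k) {a} {b} a< b< h with halving a | halving b
... | double p | double q =
  cong (_* 2) (same-bits⇒≡ k (double-cancel-< k a<) (double-cancel-< k b<)
    λ i → subst₂ _⇔_ (Bit-suc-double p i) (Bit-suc-double q i) (h (suc i)))
... | double p | double+1 q = ⊥-elim (¬Bit-zero-double p (from (h 0) (Bit-zero-double+1 q)))
... | double+1 p | double q = ⊥-elim (¬Bit-zero-double q (to (h 0) (Bit-zero-double+1 p)))
... | double+1 p | double+1 q =
  cong (λ z → 1 + z * 2) (same-bits⇒≡ k (double+1-cancel-< k a<) (double+1-cancel-< k b<)
    λ i → subst₂ _⇔_ (Bit-suc-double+1 p i) (Bit-suc-double+1 q i) (h (suc i)))

Bit-extensional : ∀ {a b} → (∀ i → Bit a i ⇔ Bit b i) → a ≡ b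
Bit-extensional {a} {b} = same-bits⇒≡ (a + b)
  (≤-<-trans (m≤m+n a b) (n<2^n _)) (≤-<-trans (m≤n+m b a) (n<2^n _))

TopDifference : ℕ → ℕ → ℕ → Set
TopDifference a b j = Bit b j × ¬ Bit a j × (∀ i → j < i → Bit a i ⇔ Bit b i)

top-suc : ∀ {a b p q j} → (∀ i → Bit a (suc i) ≡ Bit p i) → (∀ i → Bit b (suc i) ≡ Bit q i) →
          TopDifference a b (suc j) ⇔ TopDifference p q j
top-suc {a} {b} {p} {q} {j} ea eb = mk⇔
  (λ (bj , aj , h) → subst id (eb j) bj , aj ∘ subst id (sym (ea j)) ,
     λ i lt → subst₂ _⇔_ (ea i) (eb i) (h (suc i) (s≤s lt)))
  (λ (bj , aj , h) → subst id (sym (eb j)) bj , aj ∘ subst id (ea j) , up h)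
  where
  up : (∀ i → j < i → Bit p i ⇔ Bit q i) → ∀ i → suc j < i → Bit a i ⇔ Bit b i
  up h (suc i) (s≤s lt) = subst₂ _⇔_ (sym (ea i)) (sym (eb i)) (h i lt)

<⇒top-difference : ∀ k {a b} → b < 2 ^ k → a < b → ∃ (TopDifference a b)
<⇒top-difference zero (s≤s z≤n) ()
<⇒top-difference (suc k) {a} {b} b< a<b with halving a | halving b
... | double p | double q =
  let j , t = <⇒top-difference k (double-cancel-< k b<) (*-cancelʳ-< 2 p q a<b)
  in suc j , from (top-suc (Bit-suc-double p) (Bit-suc-double q)) t
... | double+1 p | double+1 q =
  let j , t = <⇒top-difference k (double+1-cancel-< k b<) (*-cancelʳ-< 2 p q (s<s⁻¹ a<b))
  in suc j , from (top-suc (Bit-suc-double+1 p) (Bit-suc-double+1 q)) t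
... | double+1 p | double q =
  let j , t = <⇒top-difference k (double-cancel-< k b<) (*-cancelʳ-< 2 p q (<-trans (n<1+n _) a<b))
  in suc j , from (top-suc (Bit-suc-double+1 p) (Bit-suc-double q)) t
-- Only here can the halves be equal, and then the top difference is bit 0; in every other case the
-- halves are strictly ordered and decide.
... | double p | double+1 q with p ≟ q
...   | yes refl = 0 , Bit-zero-double+1 q , ¬Bit-zero-double p , λ where
  (suc i) _ → subst₂ _⇔_ (sym (Bit-suc-double q i)) (sym (Bit-suc-double+1 q i)) (mk⇔ id id)
...   | no p≢q =
  let j , t = <⇒top-difference k (double+1-cancel-< k b<)
                (≤∧≢⇒< (*-cancelʳ-≤ p q 2 (s≤s⁻¹ a<b)) p≢q)
  in suc j , from (top-suc (Bit-suc-double p) (Bit-suc-double+1 q)) t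

-- If b < a, there is also a top difference in the opposite direction. The higher of the two
-- positions contradicts the agreement above the lower one; equal positions contradict each other
-- directly.
top-difference⇒< : ∀ {a b j} → TopDifference a b j → a < b
top-difference⇒< {a} {b} {j} (bj , aj , h) = ≰⇒> b≰a
  where
  b≰a : ¬ b ≤ a
  b≰a b≤a with b ≟ a
  ... | yes refl = aj bj
  ... | no b≢a with <⇒top-difference a (n<2^n a) (≤∧≢⇒< b≤a b≢a)
  ...   | i , ai , bi , g with <-cmp i j
  ...     | tri< i<j _ _ = aj (to (g j i<j) bj)
  ...     | tri≈ _ refl _ = bi bj
  ...     | tri> _ _ j<i = bi (to (h i j<i) ai)

<⇔top-difference : ∀ {a b} → a < b ⇔ ∃ (TopDifference a b)
<⇔top-difference {b = b} = mk⇔ (<⇒top-difference b (n<2^n b)) (top-difference⇒< ∘ proj₂)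

indicator : {A : Set} → Dec A → ℕ
indicator (yes _) = 1
indicator (no _)  = 0

fromBits : {P : ℕ → Set} → Decidable P → ℕ → ℕ
fromBits P? zero    = 0
fromBits P? (suc k) = indicator (P? 0) + fromBits (P? ∘ suc) k * 2

Bit-fromBits : {P : ℕ → Set} (P? : Decidable P) → ∀ k i → Bit (fromBits P? k) i ⇔ (i < k × P i)
Bit-fromBits P? zero i = mk⇔ (λ b → ⊥-elim (n≮0 (Bit⇒< 0 i b))) λ ()
Bit-fromBits P? (suc k) i with P? 0
Bit-fromBits P? (suc k) zero    | yes p = mk⇔ (λ _ → s≤s z≤n , p) λ _ → Bit-zero-double+1 (fromBits (P? ∘ suc) k)
Bit-fromBits P? (suc k) zero    | no ¬p =
  mk⇔ (λ b → ⊥-elim (¬Bit-zero-double (fromBits (P? ∘ suc) k) b)) (λ (_ , p) → ⊥-elim (¬p p))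
Bit-fromBits P? (suc k) (suc i) | yes _ rewrite Bit-suc-double+1 (fromBits (P? ∘ suc) k) i =
  let h = Bit-fromBits (P? ∘ suc) k i in
  mk⇔ (λ b → let lt , p = to h b in s≤s lt , p) (λ (lt , p) → from h (s≤s⁻¹ lt , p))
Bit-fromBits P? (suc k) (suc i) | no _ rewrite Bit-suc-double (fromBits (P? ∘ suc) k) i =
  let h = Bit-fromBits (P? ∘ suc) k i in
  mk⇔ (λ b → let lt , p = to h b in s≤s lt , p) (λ (lt , p) → from h (s≤s⁻¹ lt , p))

indicator≤1 : {A : Set} (d : Dec A) → indicator d ≤ 1
indicator≤1 (yes _) = s≤s z≤n
indicator≤1 (no _)  = z≤n

fromBits< : {P : ℕ → Set} (P? : Decidable P) → ∀ k → fromBits P? k < 2 ^ k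
fromBits< P? zero    = s≤s z≤n
fromBits< P? (suc k) = begin-strict
  indicator (P? 0) + q * 2 ≤⟨ +-monoˡ-≤ (q * 2) (indicator≤1 (P? 0)) ⟩
  1 + q * 2                <⟨ n<1+n _ ⟩
  suc q * 2                ≤⟨ *-monoˡ-≤ 2 (fromBits< (P? ∘ suc) k) ⟩
  2 ^ k * 2                ≡⟨ *-comm (2 ^ k) 2 ⟩
  2 ^ suc k                ∎
  where
  open ≤-Reasoning
  q = fromBits (P? ∘ suc) k

-- Divisibility by powers of 2

2^suc∣double : ∀ j q → 2 ^ suc j ∣ q * 2 ⇔ 2 ^ j ∣ q
2^suc∣double j q rewrite *-comm q 2 = mk⇔ (*-cancelˡ-∣ 2) (*-monoʳ-∣ 2)

2^suc∤double+1 : ∀ j q → ¬ 2 ^ suc j ∣ 1 + q * 2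
2^suc∤double+1 j q d = 2∤1+double q (∣-trans (m∣m*n (2 ^ j)) d)

2^∣⇔no-low-bits : ∀ j x → 2 ^ j ∣ x ⇔ (∀ i → i < j → ¬ Bit x i)
2^∣⇔no-low-bits zero x = mk⇔ (λ _ _ ()) (λ _ → 1∣ x)
2^∣⇔no-low-bits (suc j) x with halving x
... | double+1 q = mk⇔ (λ d → ⊥-elim (2^suc∤double+1 j q d))
                       (λ h → ⊥-elim (h 0 (s≤s z≤n) (Bit-zero-double+1 q)))
... | double q = mk⇔ no-bits (λ h → from (2^suc∣double j q) (from (2^∣⇔no-low-bits j q)
                   λ i lt → h (suc i) (s≤s lt) ∘ subst id (sym (Bit-suc-double q i))))
  where
  no-bits : 2 ^ suc j ∣ q * 2 → ∀ i → i < suc j → ¬ Bit (q * 2) i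
  no-bits d zero    _        = ¬Bit-zero-double q
  no-bits d (suc i) (s≤s lt) =
    to (2^∣⇔no-low-bits j q) (to (2^suc∣double j q) d) i lt ∘ subst id (Bit-suc-double q i)

-- `k` is the exponent of 2 in `x` plus one, which leaves the value 0 of `key` free for the numbers
-- put first.
2-adic : ∀ N x → x < 2 ^ N → ¬ x ≡ 0 → ∃ λ k → ∀ j → j < k ⇔ 2 ^ j ∣ x
2-adic zero x (s≤s z≤n) x≢0 = ⊥-elim (x≢0 refl)
2-adic (suc N) x lt x≢0 with halving x
... | double+1 q = 1 , λ where
  zero    → mk⇔ (λ _ → 1∣ _) (λ _ → s≤s z≤n)
  (suc j) → mk⇔ (λ { (s≤s ()) }) (λ d → ⊥-elim (2^suc∤double+1 j q d))
... | double q with 2-adic N q (double-cancel-< N lt) (λ { refl → x≢0 refl })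
...   | k , h = suc k , λ where
  zero    → mk⇔ (λ _ → 1∣ _) (λ _ → s≤s z≤n)
  (suc j) → mk⇔ (λ l → from (2^suc∣double j q) (to (h j) (s≤s⁻¹ l)))
                (λ d → s≤s (from (h j) (to (2^suc∣double j q) d)))

-- Tags and the order `≺`

InAdjoin : ℕ → ℕ → Set
InAdjoin i j = Bit i j ⊎ j ≡ i

InAdjoin? : ∀ i → Decidable (InAdjoin i)
InAdjoin? i j = Bit? i j ⊎-dec j ≟ i

abstract

  -- With numbers read as hereditarily finite sets, this is the set-theoretic successor. Its value
  -- is i + 2^i, because all bits of i are below i; so its top bit is i itself.
  adjoin : ℕ → ℕ
  adjoin i = fromBits (InAdjoin? i) (suc i)

  Bit-adjoin : ∀ i j → Bit (adjoin i) j ⇔ (Bit i j ⊎ j ≡ i)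
  Bit-adjoin i j = mk⇔ (proj₂ ∘ to h) (λ b → from h (bound b , b))
    where
    h : Bit (adjoin i) j ⇔ (j < suc i × InAdjoin i j)
    h = Bit-fromBits (InAdjoin? i) (suc i) j
    bound : InAdjoin i j → j < suc i
    bound (inj₁ b)    = <-trans (Bit⇒< i j b) (n<1+n i)
    bound (inj₂ refl) = n<1+n i

  i<adjoin : ∀ i → i < adjoin i
  i<adjoin i = Bit⇒< (adjoin i) i (from (Bit-adjoin i i) (inj₂ refl))

  adjoin<2^ : ∀ i → adjoin i < 2 ^ suc i
  adjoin<2^ i = fromBits< (InAdjoin? i) (suc i)

-- Oddness of i is inherited by the tag, since bit 0 is kept. The bound `i < x` makes the search for
-- i finite.
Tag : ℕ → Set
Tag x = ∃ λ i → i < x × (Bit i 0 × x ≡ adjoin i)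

Tag? : Decidable Tag
Tag? x = anyUpTo? (λ i → Bit? i 0 ×-dec x ≟ adjoin i) x

tag : ∀ {i} → Bit i 0 → Tag (adjoin i)
tag {i} odd = i , i<adjoin i , odd , refl

Tag⇒odd : ∀ {x} → Tag x → Bit x 0
Tag⇒odd (i , _ , odd , refl) = from (Bit-adjoin i 0) (inj₁ odd)

Low : ℕ → Set
Low x = x ≡ 0 ⊎ Tag x

Low? : Decidable Low
Low? x = x ≟ 0 ⊎-dec Tag? x

abstract

  key : ℕ → ℕ
  key x with Low? x
  ... | yes _ = 0
  ... | no h  = proj₁ (2-adic x x (n<2^n x) (h ∘ inj₁))

  Low⇒key≡0 : ∀ {x} → Low x → key x ≡ 0
  Low⇒key≡0 {x} l with Low? x
  ... | yes _ = refl
  ... | no h  = ⊥-elim (h l)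

  <key⇔2^∣ : ∀ {x} → ¬ Low x → ∀ j → j < key x ⇔ 2 ^ j ∣ x
  <key⇔2^∣ {x} nl with Low? x
  ... | yes l = ⊥-elim (nl l)
  ... | no h  = proj₂ (2-adic x x (n<2^n x) (h ∘ inj₁))

infix 4 _≺_

_≺_ : ℕ → ℕ → Set
x ≺ y = key x < key y ⊎ (key x ≡ key y × x < y)

_≺?_ : ∀ x y → Dec (x ≺ y)
x ≺? y = key x <? key y ⊎-dec (key x ≟ key y ×-dec x <? y)

≺-irrefl : ∀ {x y} → x ≡ y → ¬ x ≺ y
≺-irrefl refl (inj₁ lt)       = <-irrefl refl lt
≺-irrefl refl (inj₂ (_ , lt)) = <-irrefl refl lt

≺-trans : ∀ {x y z} → x ≺ y → y ≺ z → x ≺ z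
≺-trans (inj₁ p)       (inj₁ q)        = inj₁ (<-trans p q)
≺-trans (inj₁ p)       (inj₂ (e , _))  = inj₁ (<-≤-trans p (≤-reflexive e))
≺-trans (inj₂ (e , _)) (inj₁ q)        = inj₁ (≤-<-trans (≤-reflexive e) q)
≺-trans (inj₂ (e , p)) (inj₂ (e′ , q)) = inj₂ (trans e e′ , <-trans p q)

≺-asym : ∀ {x y} → x ≺ y → ¬ y ≺ x
≺-asym p q = ≺-irrefl refl (≺-trans p q)

≺-compare : Trichotomous _≡_ _≺_
≺-compare x y with <-cmp (key x) (key y)
... | tri< p _ _ = tri< (inj₁ p) (λ e → ≺-irrefl e (inj₁ p)) (≺-asym (inj₁ p))
... | tri> _ _ p = tri> (≺-asym (inj₁ p)) (λ e → ≺-irrefl (sym e) (inj₁ p)) (inj₁ p)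
... | tri≈ _ e _ with <-cmp x y
...   | tri< p _ _ = let x≺y = inj₂ (e , p) in tri< x≺y (λ e → ≺-irrefl e x≺y) (≺-asym x≺y)
...   | tri> _ _ p = let y≺x = inj₂ (sym e , p) in tri> (≺-asym y≺x) (λ e → ≺-irrefl (sym e) y≺x) y≺x
...   | tri≈ _ refl _ = tri≈ (≺-irrefl refl) refl (≺-irrefl refl)

≺-isStrictTotalOrder : IsStrictTotalOrder _≡_ _≺_
≺-isStrictTotalOrder = record
  { isStrictPartialOrder = record
    { isEquivalence = isEquivalence
    ; irrefl        = ≺-irrefl
    ; trans         = ≺-trans
    ; <-resp-≈      = resp₂ _≺_
    }
  ; compare = ≺-compare
  }

-- Formulas and interpretations

∃-cong-⇔ : {A : Set} {P Q : A → Set} → (∀ a → P a ⇔ Q a) → ∃ P ⇔ ∃ Q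
∃-cong-⇔ h = mk⇔ (λ (a , p) → a , to (h a) p) (λ (a , q) → a , from (h a) q)

∀-cong-⇔ : {A : Set} {P Q : A → Set} → (∀ a → P a ⇔ Q a) → (∀ a → P a) ⇔ (∀ a → Q a)
∀-cong-⇔ h = mk⇔ (λ p a → to (h a) (p a)) (λ q a → from (h a) (q a))

none : ∀ {n} → Structure [] n
none ()

embed : ∀ {σ τ m} → Formula [] τ m → Formula σ τ m
embed (eq x y)   = eq x y
embed (bip j xs) = bip j xs
embed (neg φ)    = neg (embed φ)
embed (and φ ψ)  = and (embed φ) (embed ψ)
embed (or φ ψ)   = or (embed φ) (embed ψ)
embed (ex φ)     = ex (embed φ)
embed (all φ)    = all (embed φ)

-- Stated over the empty signature, so that one definition serves every σ by way of `embed`.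
Interpretation : List ℕ → List ℕ → Set
Interpretation τ₁ τ₂ = ∀ {m} (j : Fin (length τ₁)) → Vec (Fin m) (lookup τ₁ j) → Formula [] τ₂ m

Defines : ∀ {τ₁ τ₂} → BuiltIns τ₁ → BuiltIns τ₂ → Interpretation τ₁ τ₂ → Set
Defines {τ₁} {τ₂} I₁ I₂ F = ∀ {m n} (ρ : Fin m → Fin (suc n)) j xs →
  I₁ j (Vec.map (λ x → toℕ (ρ x)) xs) ⇔ Sat {[]} {τ₂} I₂ n none ρ (F j xs)

module Translation {τ₁ τ₂ : List ℕ} (I₁ : BuiltIns τ₁) (I₂ : BuiltIns τ₂)
                   (F : Interpretation τ₁ τ₂) (F-defines : Defines {τ₁} {τ₂} I₁ I₂ F) where

  translate : ∀ {σ m} → Formula σ τ₁ m → Formula σ τ₂ m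
  translate (eq x y)   = eq x y
  translate (rel i xs) = rel i xs
  translate (bip j xs) = embed (F j xs)
  translate (neg φ)    = neg (translate φ)
  translate (and φ ψ)  = and (translate φ) (translate ψ)
  translate (or φ ψ)   = or (translate φ) (translate ψ)
  translate (ex φ)     = ex (translate φ)
  translate (all φ)    = all (translate φ)

  module _ {σ : List ℕ} {n : ℕ} (A : Structure σ n) where

    embed-correct : ∀ {m} (ρ : Fin m → Fin (suc n)) φ →
                    Sat {[]} {τ₂} I₂ n none ρ φ ⇔ Sat {σ} {τ₂} I₂ n A ρ (embed φ)
    embed-correct ρ (eq x y)   = ⇔-refl
    embed-correct ρ (rel () _)
    embed-correct ρ (bip j xs) = ⇔-refl
    embed-correct ρ (neg φ)    = ¬-cong-⇔ (embed-correct ρ φ)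
    embed-correct ρ (and φ ψ)  = embed-correct ρ φ ×-⇔ embed-correct ρ ψ
    embed-correct ρ (or φ ψ)   = embed-correct ρ φ ⊎-⇔ embed-correct ρ ψ
    embed-correct ρ (ex φ)     = ∃-cong-⇔ λ a → embed-correct (extend a ρ) φ
    embed-correct ρ (all φ)    = ∀-cong-⇔ λ a → embed-correct (extend a ρ) φ

    translate-correct : ∀ {m} (ρ : Fin m → Fin (suc n)) (φ : Formula σ τ₁ m) →
                        Sat {σ} {τ₁} I₁ n A ρ φ ⇔ Sat {σ} {τ₂} I₂ n A ρ (translate φ)
    translate-correct ρ (eq x y)   = ⇔-refl
    translate-correct ρ (rel i xs) = ⇔-refl
    translate-correct ρ (bip j xs) = ⇔-trans (F-defines ρ j xs) (embed-correct ρ (F j xs))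
    translate-correct ρ (neg φ)    = ¬-cong-⇔ (translate-correct ρ φ)
    translate-correct ρ (and φ ψ)  = translate-correct ρ φ ×-⇔ translate-correct ρ ψ
    translate-correct ρ (or φ ψ)   = translate-correct ρ φ ⊎-⇔ translate-correct ρ ψ
    translate-correct ρ (ex φ)     = ∃-cong-⇔ λ a → translate-correct (extend a ρ) φ
    translate-correct ρ (all φ)    = ∀-cong-⇔ λ a → translate-correct (extend a ρ) φ

  definable⇒AtMostAsExpressive : AtMostAsExpressive {τ₁} {τ₂} I₁ I₂
  definable⇒AtMostAsExpressive σ φ = translate φ , λ n A → translate-correct A empty φ

imp iff : ∀ {σ τ m} → Formula σ τ m → Formula σ τ m → Formula σ τ m
imp φ ψ = or (neg φ) ψ
iff φ ψ = and (imp φ ψ) (imp ψ φ)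

val : ∀ {m n} → (Fin m → Fin (suc n)) → Fin m → ℕ
val ρ x = toℕ (ρ x)

val≤ : ∀ {m n} (ρ : Fin m → Fin (suc n)) x → val ρ x ≤ n
val≤ ρ x = ≤-pred (toℕ<n (ρ x))

-- Implication is coded by `neg` and `or`, so reading it back as a function type needs decidable
-- satisfaction. The relations of an arbitrary structure are not decidable; the built-in ones are,
-- hence the restriction to formulas over the empty signature.
module Semantics {τ : List ℕ} (I : BuiltIns τ) (I? : ∀ j v → Dec (I j v)) where

  infix 4 _⊨_

  -- A record, so that ρ and φ can be inferred from ρ ⊨ φ.
  record _⊨_ {m n : ℕ} (ρ : Fin m → Fin (suc n)) (φ : Formula [] τ m) : Set where
    constructor satisfies
    field
      satisfied : Sat {[]} {τ} I n none ρ φ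

  open _⊨_ public

  private
    sat? : ∀ {m n} (ρ : Fin m → Fin (suc n)) φ → Dec (Sat {[]} {τ} I n none ρ φ)
    sat? ρ (eq x y)   = ρ x ≟ᶠ ρ y
    sat? ρ (rel () _)
    sat? ρ (bip j xs) = I? j _
    sat? ρ (neg φ)    = ¬? (sat? ρ φ)
    sat? ρ (and φ ψ)  = sat? ρ φ ×-dec sat? ρ ψ
    sat? ρ (or φ ψ)   = sat? ρ φ ⊎-dec sat? ρ ψ
    sat? ρ (ex φ)     = any? λ a → sat? (extend a ρ) φ
    sat? ρ (all φ)    = all? λ a → sat? (extend a ρ) φ

  ⊨⇔Sat : ∀ {m n} {ρ : Fin m → Fin (suc n)} {φ} → ρ ⊨ φ ⇔ Sat {[]} {τ} I n none ρ φ
  ⊨⇔Sat = mk⇔ satisfied satisfies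

  module _ {m n : ℕ} {ρ : Fin m → Fin (suc n)} where

    ⊨bip : ∀ j xs → ρ ⊨ bip j xs ⇔ I j (Vec.map (val ρ) xs)
    ⊨bip j xs = mk⇔ satisfied satisfies

    ⊨eq : ∀ x y → ρ ⊨ eq x y ⇔ val ρ x ≡ val ρ y
    ⊨eq x y = mk⇔ (cong toℕ ∘ satisfied) (satisfies ∘ toℕ-injective)

    ⊨neg : ∀ {φ} {P : Set} → ρ ⊨ φ ⇔ P → ρ ⊨ neg φ ⇔ (¬ P)
    ⊨neg h = ⇔-trans ⊨⇔Sat (¬-cong-⇔ (⇔-trans (⇔-sym ⊨⇔Sat) h))

    ⊨and : ∀ {φ ψ} {P Q : Set} → ρ ⊨ φ ⇔ P → ρ ⊨ ψ ⇔ Q → ρ ⊨ and φ ψ ⇔ (P × Q)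
    ⊨and h k = ⇔-trans ⊨⇔Sat (⇔-trans (⇔-sym ⊨⇔Sat) h ×-⇔ ⇔-trans (⇔-sym ⊨⇔Sat) k)

    ⊨or : ∀ {φ ψ} {P Q : Set} → ρ ⊨ φ ⇔ P → ρ ⊨ ψ ⇔ Q → ρ ⊨ or φ ψ ⇔ (P ⊎ Q)
    ⊨or h k = ⇔-trans ⊨⇔Sat (⇔-trans (⇔-sym ⊨⇔Sat) h ⊎-⇔ ⇔-trans (⇔-sym ⊨⇔Sat) k)

    ⊨imp : ∀ {φ ψ} {P Q : Set} → ρ ⊨ φ ⇔ P → ρ ⊨ ψ ⇔ Q → ρ ⊨ imp φ ψ ⇔ (P → Q)
    ⊨imp {φ} {ψ} {P} {Q} h k = ⇔-trans (⊨or (⊨neg h) k) (mk⇔ elim intro)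
      where
      elim : ¬ P ⊎ Q → P → Q
      elim (inj₁ ¬p) p = ⊥-elim (¬p p)
      elim (inj₂ q)  _ = q
      intro : (P → Q) → ¬ P ⊎ Q
      intro f with sat? ρ φ
      ... | yes p = inj₂ (f (to h (satisfies p)))
      ... | no ¬p = inj₁ (¬p ∘ satisfied ∘ from h)

    ⊨iff : ∀ {φ ψ} {P Q : Set} → ρ ⊨ φ ⇔ P → ρ ⊨ ψ ⇔ Q → ρ ⊨ iff φ ψ ⇔ (P ⇔ Q)
    ⊨iff h k = ⇔-trans (⊨and (⊨imp h k) (⊨imp k h))
                       (mk⇔ (λ (f , g) → mk⇔ f g) (λ e → to e , from e))

    ⊨ex : ∀ {φ} {P : ℕ → Set} → (∀ a → extend a ρ ⊨ φ ⇔ P (toℕ a)) →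
          ρ ⊨ ex φ ⇔ (∃ λ k → k ≤ n × P k)
    ⊨ex {φ} {P} h = mk⇔
      (λ { (satisfies (a , s)) → toℕ a , ≤-pred (toℕ<n a) , to (h a) (satisfies s) })
      (λ (k , k≤n , p) → satisfies (fromℕ< (s≤s k≤n) ,
        satisfied (from (h _) (subst P (sym (toℕ-fromℕ< (s≤s k≤n))) p))))

    ⊨all : ∀ {φ} {P : ℕ → Set} → (∀ a → extend a ρ ⊨ φ ⇔ P (toℕ a)) →
           ρ ⊨ all φ ⇔ (∀ k → k ≤ n → P k)
    ⊨all {φ} {P} h = mk⇔
      (λ { (satisfies f) k k≤n → subst P (toℕ-fromℕ< (s≤s k≤n)) (to (h _) (satisfies (f (fromℕ< (s≤s k≤n))))) })
      (λ f → satisfies λ a → satisfied (from (h a) (f (toℕ a) (≤-pred (toℕ<n a)))))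

-- Bit from < and ≺

0<2^ : ∀ i → 0 < 2 ^ i
0<2^ = m^n>0 2

¬Low-2^ : ∀ i → ¬ Low (2 ^ i)
¬Low-2^ i       (inj₁ e) = <-irrefl (sym e) (0<2^ i)
¬Low-2^ zero    (inj₂ (zero , _ , odd , _)) = n≮0 (Bit⇒< 0 0 odd)
¬Low-2^ zero    (inj₂ (suc _ , s≤s () , _))
¬Low-2^ (suc i) (inj₂ t) = to (Bit-zero (2 ^ suc i)) (Tag⇒odd t) (m∣m*n (2 ^ i))

2^∣2^⇒≤ : ∀ {i j} → 2 ^ i ∣ 2 ^ j → i ≤ j
2^∣2^⇒≤ {i} {j} d = ≮⇒≥ λ lt → <⇒≱ (2^-mono-< lt) (∣⇒≤ {{m^n≢0 2 j}} d)

2^-mono-∣ : ∀ {i j} → i ≤ j → 2 ^ i ∣ 2 ^ j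
2^-mono-∣ {j = j} z≤n = 1∣ (2 ^ j)
2^-mono-∣ (s≤s h)     = *-monoʳ-∣ 2 (2^-mono-∣ h)

2^∣⇒2^≤ : ∀ {i x} → ¬ x ≡ 0 → 2 ^ i ∣ x → 2 ^ i ≤ x
2^∣⇒2^≤ x≢0 d = ∣⇒≤ {{≢-nonZero x≢0}} d

key-2^ : ∀ i → key (2 ^ i) ≡ suc i
key-2^ i = ≤-antisym
  (≮⇒≥ λ lt → 1+n≰n (2^∣2^⇒≤ {suc i} {i} (to (<key⇔2^∣ (¬Low-2^ i) (suc i)) lt)))
  (from (<key⇔2^∣ (¬Low-2^ i) i) ∣-refl)

-- 1 is not low, so its key is 1, and it is the least positive number; hence what precedes it has
-- key 0. This makes tags definable.
≺1⇔Low : ∀ y → y ≺ 1 ⇔ Low y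
≺1⇔Low y = mk⇔ low λ l → inj₁ (subst₂ _<_ (sym (Low⇒key≡0 l)) (sym (key-2^ 0)) (s≤s z≤n))
  where
  low : y ≺ 1 → Low y
  low p with toSum (Low? y)
  ... | inj₁ l = l
  low (inj₂ (_ , s≤s z≤n)) | inj₂ _ = inj₁ refl
  low (inj₁ lt) | inj₂ nl = ⊥-elim (<⇒≱ (subst (key y <_) (key-2^ 0) lt)
                                      (from (<key⇔2^∣ nl 0) (1∣ y)))

-- A power of 2 is the least number with its key, so its predecessors are exactly the numbers of
-- smaller key. Tags fit in because they are odd and the power is even; this is why the exponent is
-- `suc i`.
≺2^⇔2^∤ : ∀ i y → ¬ y ≡ 0 → y ≺ 2 ^ suc i ⇔ (¬ 2 ^ suc i ∣ y)
≺2^⇔2^∤ i y y≢0 = mk⇔ forth back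
  where
  p = 2 ^ suc i
  forth : y ≺ p → ¬ p ∣ y
  forth (inj₂ (_ , y<p)) d = <⇒≱ y<p (2^∣⇒2^≤ {suc i} y≢0 d)
  forth (inj₁ lt) d with toSum (Low? y)
  ... | inj₁ (inj₁ y≡0) = y≢0 y≡0
  ... | inj₁ (inj₂ t) = to (Bit-zero y) (Tag⇒odd t) (∣-trans (m∣m*n (2 ^ i)) d)
  ... | inj₂ nl = <⇒≱ (subst (key y <_) (key-2^ (suc i)) lt) (from (<key⇔2^∣ nl (suc i)) d)
  back : ¬ p ∣ y → y ≺ p
  back p∤y with toSum (Low? y)
  ... | inj₁ l = inj₁ (subst₂ _<_ (sym (Low⇒key≡0 l)) (sym (key-2^ (suc i))) (s≤s z≤n))
  ... | inj₂ nl = inj₁ (subst (key y <_) (sym (key-2^ (suc i)))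
                  (s≤s (≮⇒≥ (p∤y ∘ to (<key⇔2^∣ nl (suc i))))))

Power : ℕ → Set
Power p = ∃ λ i → p ≡ 2 ^ i

power≺⇒< : ∀ i {y} → 2 ^ i ≺ y → 2 ^ i < y
power≺⇒< i (inj₂ (_ , lt)) = lt
power≺⇒< i {y} (inj₁ lt) with toSum (Low? y)
... | inj₁ l = ⊥-elim (n≮0 (subst (_ <_) (Low⇒key≡0 l) lt))
... | inj₂ nl = <-≤-trans (2^-mono-< (n<1+n i)) (2^∣⇒2^≤ {suc i} (nl ∘ inj₁)
                (to (<key⇔2^∣ nl (suc i)) (subst (_< key y) (key-2^ i) lt)))

2^∣<2^suc⇒≡ : ∀ {i p} → ¬ p ≡ 0 → 2 ^ i ∣ p → p < 2 ^ suc i → p ≡ 2 ^ i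
2^∣<2^suc⇒≡ p≢0 (divides zero e) _ = ⊥-elim (p≢0 e)
2^∣<2^suc⇒≡ _ (divides 1 e) _ = trans e (*-identityˡ _)
2^∣<2^suc⇒≡ {i} _ (divides (suc (suc q)) refl) lt =
  ⊥-elim (<⇒≱ lt (*-monoˡ-≤ (2 ^ i) (s≤s (s≤s (z≤n {q})))))

-- A tag fails the test at y = 1. Any other positive p, with exponent i, precedes 2^(i+1) in `≺`;
-- passing the test there leaves 2^i as the only multiple of 2^i available.
power-iff : ∀ {n p} → p ≤ n → (¬ p ≡ 0 × (∀ y → y ≤ n → p ≺ y → p < y)) ⇔ Power p
power-iff {n} {p} p≤n = mk⇔ forth λ { (i , refl) →
    (λ e → <-irrefl (sym e) (0<2^ i)) , λ y _ → power≺⇒< i }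
  where
  forth : ¬ p ≡ 0 × (∀ y → y ≤ n → p ≺ y → p < y) → Power p
  forth (p≢0 , h) with toSum (Low? p)
  ... | inj₁ l = ⊥-elim (p≢0 (n<1⇒n≡0 (h 1 (≤-trans (n≢0⇒n>0 p≢0) p≤n) (from (≺1⇔Low p) l))))
  ... | inj₂ nl = i , 2^∣<2^suc⇒≡ {i} p≢0 (to (<key⇔2^∣ nl i) (≤-reflexive (sym key≡))) p<2^
    where
    i = pred (key p)
    key≡ : key p ≡ suc i
    key≡ = sym (suc-pred (key p) {{>-nonZero (from (<key⇔2^∣ nl 0) (1∣ p))}})
    p≺2^ : p ≺ 2 ^ suc i
    p≺2^ = from (≺2^⇔2^∤ i p p≢0) λ d →
      1+n≰n (subst (suc i <_) key≡ (from (<key⇔2^∣ nl (suc i)) d))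
    p<2^ : p < 2 ^ suc i
    -- The test cannot be applied when 2^(i+1) lies outside [n], but then p ≤ n already gives the
    -- bound.
    p<2^ with 2 ^ suc i ≤? n
    ... | yes le = h _ le p≺2^
    ... | no ¬le = ≤-<-trans p≤n (≰⇒> ¬le)

multiple≤⇔≤quotient : ∀ i c a → c * 2 ^ i ≤ a ⇔ c ≤ _/_ a (2 ^ i) {{m^n≢0 2 i}}
multiple≤⇔≤quotient i c a = mk⇔
  (λ h → subst (_≤ a / 2 ^ i) (m*n/n≡m c (2 ^ i)) (/-monoˡ-≤ (2 ^ i) h))
  (λ h → ≤-trans (*-monoˡ-≤ (2 ^ i) h) (m/n*n≤m a (2 ^ i)))
  where instance _ = m^n≢0 2 i

BitAt : ℕ → ℕ → Set
BitAt a p = ∃ λ i → p ≡ 2 ^ i × Bit a i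

-- The case p = 1 is separate because tags precede 1 in `≺` although 1 divides them.
Divides : ℕ → ℕ → Set
Divides p y = p ≡ 1 ⊎ ¬ y ≺ p

Divides⇔2^∣ : ∀ i y → ¬ y ≡ 0 → Divides (2 ^ i) y ⇔ 2 ^ i ∣ y
Divides⇔2^∣ zero    y y≢0 = mk⇔ (λ _ → 1∣ y) (λ _ → inj₁ refl)
Divides⇔2^∣ (suc i) y y≢0 = mk⇔ forth (λ d → inj₂ λ y≺p → to (≺2^⇔2^∤ i y y≢0) y≺p d)
  where
  forth : Divides (2 ^ suc i) y → 2 ^ suc i ∣ y
  forth (inj₁ e) = ⊥-elim (<-irrefl (sym e) (2^-mono-< {0} {suc i} (s≤s z≤n)))
  forth (inj₂ h) = decidable-stable (2 ^ suc i ∣? y) (h ∘ from (≺2^⇔2^∤ i y y≢0))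

-- The largest multiple y ≤ a of 2^i is ⌊a / 2^i⌋ · 2^i, so the bit is set iff 2^(i+1) ∤ y.
LargestMultiple : ℕ → ℕ → ℕ → ℕ → Set
LargestMultiple n a p y =
  ¬ a < y × ¬ y ≡ 0 × Divides p y ×
  (∀ q → q ≤ n → Power q × p < q → y ≺ q) ×
  (∀ z → z ≤ n → y < z × ¬ a < z → ¬ Divides p z)

-- The larger powers within [n] stand in for 2^(i+1), which may exceed n. Nothing is lost: if
-- 2^(i+1) divides the nonzero y, it is at most y and so lies in [n]. A set bit makes the quotient
-- odd, hence y nonzero.
bitAt-iff : ∀ {n} a p → a ≤ n →
  (Power p × ∃ λ y → y ≤ n × LargestMultiple n a p y) ⇔ BitAt a p
bitAt-iff {n} a p a≤n = mk⇔ forth back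
  where
  forth : (Power p × ∃ λ y → y ≤ n × LargestMultiple n a p y) → BitAt a p
  forth ((i , refl) , y , y≤n , y≤a , y≢0 , d , next , largest)
    with to (Divides⇔2^∣ i y y≢0) d
  ... | divides c refl = i , refl , λ 2∣q → 2^∤y (subst (2 ^ suc i ∣_) y≡ (*-monoˡ-∣ (2 ^ i) 2∣q))
    where
    instance _ = m^n≢0 2 i
    q = a / 2 ^ i
    c≤q : c ≤ q
    c≤q = to (multiple≤⇔≤quotient i c a) (≮⇒≥ y≤a)
    q≤c : q ≤ c
    q≤c = ≮⇒≥ λ c<q → largest (q * 2 ^ i) (≤-trans (m/n*n≤m a (2 ^ i)) a≤n)
      (*-monoˡ-< (2 ^ i) c<q , ≤⇒≯ (m/n*n≤m a (2 ^ i)))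
      (from (Divides⇔2^∣ i (q * 2 ^ i) λ e → n≮0 (subst (c * 2 ^ i <_) e (*-monoˡ-< (2 ^ i) c<q)))
            (n∣m*n q))
    y≡ : q * 2 ^ i ≡ c * 2 ^ i
    y≡ = cong (_* 2 ^ i) (≤-antisym q≤c c≤q)
    2^∤y : ¬ 2 ^ suc i ∣ c * 2 ^ i
    2^∤y d′ = to (≺2^⇔2^∤ i _ y≢0)
      (next (2 ^ suc i) (≤-trans (2^∣⇒2^≤ {suc i} y≢0 d′) y≤n) ((suc i , refl) , 2^-mono-< (n<1+n i))) d′
  back : BitAt a p → Power p × ∃ λ y → y ≤ n × LargestMultiple n a p y
  back (i , refl , bit) = (i , refl) , y , ≤-trans y≤a a≤n , ≤⇒≯ y≤a , y≢0 ,
      from (Divides⇔2^∣ i y y≢0) (n∣m*n q) , next , largest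
    where
    instance _ = m^n≢0 2 i
    q = a / 2 ^ i
    y = q * 2 ^ i
    y≤a : y ≤ a
    y≤a = m/n*n≤m a (2 ^ i)
    y≢0 : ¬ y ≡ 0
    y≢0 e = bit (subst (2 ∣_) (sym (m*n≡0⇒m≡0 q (2 ^ i) e)) (2 ∣0))
    next : ∀ q′ → q′ ≤ n → Power q′ × 2 ^ i < q′ → y ≺ q′
    next _ _ ((zero , refl) , lt) = ⊥-elim (<⇒≱ lt (0<2^ i))
    next _ _ ((suc j , refl) , lt) = from (≺2^⇔2^∤ j y y≢0) λ d →
      bit (*-cancelʳ-∣ (2 ^ i) (∣-trans (2^-mono-∣ {suc i} {suc j} (2^-cancel-< {i} {suc j} lt)) d))
    largest : ∀ z → z ≤ n → y < z × ¬ a < z → ¬ Divides (2 ^ i) z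
    largest z _ (y<z , z≤a) d with to (Divides⇔2^∣ i z (λ { refl → n≮0 y<z })) d
    ... | divides c refl =
      <⇒≱ y<z (*-monoˡ-≤ (2 ^ i) (to (multiple≤⇔≤quotient i c a) (≮⇒≥ z≤a)))

-- Exponentiation from tags

BitAt-2^ : ∀ a j → BitAt a (2 ^ j) ⇔ Bit a j
BitAt-2^ a j = mk⇔ (λ (i , e , b) → subst (Bit a) (sym (2^-injective {j} {i} e)) b) (λ b → j , refl , b)

tag-iff : ∀ {n t} → t ≤ n → (¬ t ≡ 0 × (∀ o → o ≤ n → o ≡ 1 → t ≺ o)) ⇔ Tag t
tag-iff {n} {t} t≤n = mk⇔ forth λ { tg@(i , i<t , _) →
    (λ { refl → n≮0 i<t }) , λ { _ _ refl → from (≺1⇔Low t) (inj₂ tg) } }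
  where
  forth : ¬ t ≡ 0 × (∀ o → o ≤ n → o ≡ 1 → t ≺ o) → Tag t
  forth (t≢0 , h) with to (≺1⇔Low t) (h 1 (≤-trans (n≢0⇒n>0 t≢0) t≤n) refl)
  ... | inj₁ t≡0 = ⊥-elim (t≢0 t≡0)
  ... | inj₂ tg  = tg

-- The equation between t and i with its new element is tested at powers `q`, since only bits at
-- powers are expressible so far. The clause `i < p` puts the new element above all bits of i.
TagFor : ℕ → ℕ → ℕ → ℕ → Set
TagFor n i p t = Tag t × Power p × i < p ×
  (∀ q → q ≤ n → Power q → BitAt t q ⇔ (BitAt i q ⊎ q ≡ p))

TaggedExp : ℕ → ℕ → ℕ → Set
TaggedExp n i p = Bit i 0 × p ≡ 2 ^ i × adjoin i ≤ n

-- Both decompositions of t, as i with k and as i′ with i′, split off its top bit. So k = i′, and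
-- what remains gives i = i′.
taggedExp-iff : ∀ {n} i p → i ≤ n → p ≤ n → (∃ λ t → t ≤ n × TagFor n i p t) ⇔ TaggedExp n i p
taggedExp-iff {n} i p i≤n p≤n = mk⇔ forth back
  where
  forth : (∃ λ t → t ≤ n × TagFor n i p t) → TaggedExp n i p
  forth (_ , t≤n , (i′ , _ , odd , refl) , (k , refl) , i<2^k , h) =
    subst (λ z → Bit z 0) (sym i≡i′) odd , cong (2 ^_) (trans k≡i′ (sym i≡i′)) ,
    subst (λ z → adjoin z ≤ n) (sym i≡i′) t≤n
    where
    bits : ∀ j → 2 ^ j ≤ n → Bit (adjoin i′) j ⇔ (Bit i j ⊎ j ≡ k)
    bits j le = ⇔-trans (⇔-sym (BitAt-2^ (adjoin i′) j)) (⇔-trans (h _ le (j , refl))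
      (BitAt-2^ i j ⊎-⇔ mk⇔ (2^-injective {j} {k}) (cong (2 ^_))))
    visible : ∀ {j} → Bit (adjoin i′) j → 2 ^ j ≤ n
    visible {j} b = ≤-trans (Bit⇒2^≤ (adjoin i′) j b) t≤n
    ¬Bit-i-k : ¬ Bit i k
    ¬Bit-i-k b = <⇒≱ i<2^k (Bit⇒2^≤ i k b)
    top : Bit (adjoin i′) i′
    top = from (Bit-adjoin i′ i′) (inj₂ refl)
    k≡i′ : k ≡ i′
    k≡i′ with to (Bit-adjoin i′ k) (from (bits k p≤n) (inj₂ refl)) | to (bits i′ (visible {i′} top)) top
    ... | inj₂ e | _ = e
    ... | _ | inj₂ e = sym e
    -- k as a bit of i′ gives k < i′, while i′ as a bit of i < 2^k gives i′ < k.
    ... | inj₁ b | inj₁ b′ = ⊥-elim (<-asym (Bit⇒< i′ k b)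
                               (2^-cancel-< {i′} {k} (≤-<-trans (Bit⇒2^≤ i i′ b′) i<2^k)))
    i≡i′ : i ≡ i′
    i≡i′ = Bit-extensional λ j → mk⇔ (→′ j) (←′ j)
      where
      →′ : ∀ j → Bit i j → Bit i′ j
      →′ j b with to (Bit-adjoin i′ j) (from (bits j (≤-trans (Bit⇒2^≤ i j b) i≤n)) (inj₁ b))
      ... | inj₁ b′ = b′
      ... | inj₂ e = ⊥-elim (¬Bit-i-k (subst (Bit i) (trans e (sym k≡i′)) b))
      ←′ : ∀ j → Bit i′ j → Bit i j
      ←′ j b with to (bits j (visible {j} b′)) b′
        where
        b′ : Bit (adjoin i′) j
        b′ = from (Bit-adjoin i′ j) (inj₁ b)
      ... | inj₁ b″ = b″
      ... | inj₂ e = ⊥-elim (<-irrefl (trans e k≡i′) (Bit⇒< i′ j b))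
  back : TaggedExp n i p → ∃ λ t → t ≤ n × TagFor n i p t
  back (odd , refl , le) = adjoin i , le , tag odd , (i , refl) , n<2^n i , λ where
    q _ (j , refl) → ⇔-trans (BitAt-2^ (adjoin i) j) (⇔-trans (Bit-adjoin i j)
      (⇔-sym (BitAt-2^ i j ⊎-⇔ mk⇔ (2^-injective {j} {i}) (cong (2 ^_)))))

Successor : ℕ → ℕ → Set
Successor i j = j ≡ suc i

successor-iff : ∀ {n i j} → j ≤ n → (i < j × ¬ ∃ λ k → k ≤ n × (i < k × k < j)) ⇔ Successor i j
successor-iff {n} {i} j≤n = mk⇔
  (λ (i<j , h) → ≤-antisym (≮⇒≥ λ lt → h (suc i , ≤-trans i<j j≤n , n<1+n i , lt)) i<j)
  λ { refl → n<1+n i , λ (k , _ , i<k , k<j) → <⇒≱ k<j i<k }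

Doubled : ℕ → ℕ → Set
Doubled p q = ∃ λ i → p ≡ 2 ^ i × q ≡ 2 ^ suc i

doubled-iff : ∀ {n p q} → q ≤ n →
  ((Power p × Power q) × (p < q × ¬ ∃ λ r → r ≤ n × (Power r × (p < r × r < q)))) ⇔ Doubled p q
doubled-iff {n} {p} {q} q≤n = mk⇔ forth λ { (i , refl , refl) →
    ((i , refl) , (suc i , refl)) , 2^-mono-< (n<1+n i) ,
    λ { (_ , _ , (k , refl) , lt , lt′) → <⇒≱ (2^-cancel-< {k} {suc i} lt′) (2^-cancel-< {i} {k} lt) } }
  where
  forth : (Power p × Power q) × (p < q × ¬ ∃ λ r → r ≤ n × (Power r × (p < r × r < q))) → Doubled p q
  forth (((i , refl) , (j , refl)) , lt , h) = i , refl , cong (2 ^_) (≤-antisym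
    (≮⇒≥ λ si<j → h (2 ^ suc i , ≤-trans (2^-mono-≤ i<j) q≤n , (suc i , refl) ,
                      2^-mono-< (n<1+n i) , 2^-mono-< si<j))
    i<j)
    where
    i<j = 2^-cancel-< {i} {j} lt

BaseExp : ℕ → ℕ → ℕ → Set
BaseExp n i p = TaggedExp n i p ⊎ (i ≡ 0 × p ≡ 1)

StepExp : ℕ → (ℕ → ℕ → Set) → ℕ → ℕ → Set
StepExp n R i q = ∃ λ j → j ≤ n × ∃ λ p → p ≤ n × (R j p × (Successor j i × Doubled p q))

odd∨odd-suc : ∀ k → Bit k 0 ⊎ Bit (suc k) 0
odd∨odd-suc k with halving k
... | double q   = inj₂ (Bit-zero-double+1 q)
... | double+1 q = inj₁ (Bit-zero-double+1 q)

-- The tag of an odd k is below 2^(k+1), so it exists in [n] as soon as 2^(k+1) does;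
-- every exponent other than 0 and 1 is one or two steps above a tagged one.
exp-iff : ∀ {n} i p → i ≤ n → p ≤ n →
  (BaseExp n i p ⊎ (StepExp n (BaseExp n) i p ⊎ StepExp n (StepExp n (BaseExp n)) i p)) ⇔ (p ≡ 2 ^ i)
exp-iff {n} i p i≤n p≤n = mk⇔ forth λ { refl → back i i≤n p≤n }
  where
  base : ∀ {i p} → BaseExp n i p → p ≡ 2 ^ i
  base (inj₁ (_ , e , _))     = e
  base (inj₂ (refl , refl)) = refl
  step : ∀ {R} → (∀ {i p} → R i p → p ≡ 2 ^ i) → ∀ {i p} → StepExp n R i p → p ≡ 2 ^ i
  step sound (j , _ , _ , _ , r , refl , (k , refl , refl)) = cong (2 *_) (sound r)
  forth : BaseExp n i p ⊎ (StepExp n (BaseExp n) i p ⊎ StepExp n (StepExp n (BaseExp n)) i p) → p ≡ 2 ^ i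
  forth (inj₁ b)        = base b
  forth (inj₂ (inj₁ s)) = step base s
  forth (inj₂ (inj₂ s)) = step (step base) s
  up : ∀ {R} i → suc i ≤ n → 2 ^ suc i ≤ n → R i (2 ^ i) → StepExp n R (suc i) (2 ^ suc i)
  up i le le′ r = i , ≤-trans (n≤1+n i) le , 2 ^ i , ≤-trans (<⇒≤ (2^-mono-< (n<1+n i))) le′ ,
    r , refl , (i , refl , refl)
  tagged : ∀ k → Bit k 0 → 2 ^ suc k ≤ n → BaseExp n k (2 ^ k)
  tagged k odd le = inj₁ (odd , refl , ≤-trans (<⇒≤ (adjoin<2^ k)) le)
  back : ∀ i → i ≤ n → 2 ^ i ≤ n →
         BaseExp n i (2 ^ i) ⊎ (StepExp n (BaseExp n) i (2 ^ i) ⊎ StepExp n (StepExp n (BaseExp n)) i (2 ^ i))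
  back 0 le le′ = inj₁ (inj₂ (refl , refl))
  back 1 le le′ = inj₂ (inj₁ (up 0 le le′ (inj₂ (refl , refl))))
  back (suc (suc k)) le le′ with odd∨odd-suc k
  -- The exponent k + 2 is odd as well, but its own tag may exceed n even though 2^(k+2) does not;
  -- so the nearest odd exponent below it is used.
  ... | inj₁ odd = inj₂ (inj₂ (up (suc k) le le′ (up k (≤-trans (n≤1+n _) le) le″ (tagged k odd le″))))
    where
    le″ : 2 ^ suc k ≤ n
    le″ = ≤-trans (2^-mono-≤ (n≤1+n (suc k))) le′
  ... | inj₂ odd = inj₂ (inj₁ (up (suc k) le le′ (tagged (suc k) odd le′)))

bit-iff : ∀ {n} a i → a ≤ n → (∃ λ p → p ≤ n × (p ≡ 2 ^ i × BitAt a p)) ⇔ Bit a i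
bit-iff a i a≤n = mk⇔ (λ { (_ , _ , refl , b) → to (BitAt-2^ a i) b })
  λ b → 2 ^ i , ≤-trans (Bit⇒2^≤ a i b) a≤n , refl , from (BitAt-2^ a i) b

-- Formulas in `<` and `≺`

module FromOrders where

  LtPrec? : ∀ j v → Dec (LtPrec _≺_ j v)
  LtPrec? zero       (a ∷ b ∷ []) = a <? b
  LtPrec? (suc zero) (a ∷ b ∷ []) = a ≺? b

  open Semantics (LtPrec _≺_) LtPrec?

  Formula₂ : ℕ → Set
  Formula₂ = Formula [] (2 ∷ 2 ∷ [])

  ltF precF : ∀ {m} → Fin m → Fin m → Formula₂ m
  ltF x y   = bip zero (x ∷ y ∷ [])
  precF x y = bip (suc zero) (x ∷ y ∷ [])

  zeroF oneF powerF : ∀ {m} → Fin m → Formula₂ m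
  zeroF x  = all (neg (ltF zero (suc x)))
  oneF x   = and (neg (zeroF x)) (all (imp (ltF zero (suc x)) (zeroF zero)))
  powerF x = and (neg (zeroF x)) (all (imp (precF (suc x) zero) (ltF (suc x) zero)))

  dividesF bitAtF : ∀ {m} → Fin m → Fin m → Formula₂ m
  dividesF p y = or (oneF p) (neg (precF y p))
  bitAtF a p = and (powerF p) (ex (and (neg (ltF (suc a) zero)) (and (neg (zeroF zero)) (and
    (dividesF (suc p) zero) (and
    (all (imp (and (powerF zero) (ltF (suc (suc p)) zero)) (precF (suc zero) zero)))
    (all (imp (and (ltF (suc zero) zero) (neg (ltF (suc (suc a)) zero)))
              (neg (dividesF (suc (suc p)) zero)))))))))

  module _ {n : ℕ} where

    zero-iff : ∀ {x} → (∀ k → k ≤ n → ¬ k < x) ⇔ x ≡ 0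
    zero-iff = mk⇔ (λ h → n<1⇒n≡0 (≰⇒> (h 0 z≤n))) λ { refl _ _ () }

    one-iff : ∀ {x} → x ≤ n → (¬ x ≡ 0 × (∀ k → k ≤ n → k < x → k ≡ 0)) ⇔ x ≡ 1
    one-iff {x} x≤n = mk⇔ forth λ { refl → (λ ()) , λ { zero _ _ → refl ; (suc _) _ (s≤s ()) } }
      where
      forth : ¬ x ≡ 0 × (∀ k → k ≤ n → k < x → k ≡ 0) → x ≡ 1
      forth (x≢0 , h) = ≤-antisym
        (≮⇒≥ λ 1<x → 1+n≢0 (h 1 (≤-trans (<⇒≤ 1<x) x≤n) 1<x))
        (n≢0⇒n>0 x≢0)

  module _ {m n : ℕ} {ρ : Fin m → Fin (suc n)} where

    ⊨lt : ∀ x y → ρ ⊨ ltF x y ⇔ val ρ x < val ρ y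
    ⊨lt x y = ⊨bip zero _

    ⊨prec : ∀ x y → ρ ⊨ precF x y ⇔ val ρ x ≺ val ρ y
    ⊨prec x y = ⊨bip (suc zero) _

  module _ {n : ℕ} where

    ⊨zero : ∀ {m} {ρ : Fin m → Fin (suc n)} x → ρ ⊨ zeroF x ⇔ val ρ x ≡ 0
    ⊨zero x = ⇔-trans (⊨all λ _ → ⊨neg (⊨lt zero (suc x))) zero-iff

    ⊨one : ∀ {m} {ρ : Fin m → Fin (suc n)} x → ρ ⊨ oneF x ⇔ val ρ x ≡ 1
    ⊨one {ρ = ρ} x = ⇔-trans
      (⊨and (⊨neg (⊨zero x)) (⊨all λ _ → ⊨imp (⊨lt zero (suc x)) (⊨zero zero)))
      (one-iff (val≤ ρ x))

    ⊨power : ∀ {m} {ρ : Fin m → Fin (suc n)} x → ρ ⊨ powerF x ⇔ Power (val ρ x)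
    ⊨power {ρ = ρ} x = ⇔-trans
      (⊨and (⊨neg (⊨zero x)) (⊨all λ _ → ⊨imp (⊨prec (suc x) zero) (⊨lt (suc x) zero)))
      (power-iff (val≤ ρ x))

    ⊨divides : ∀ {m} {ρ : Fin m → Fin (suc n)} p y → ρ ⊨ dividesF p y ⇔ Divides (val ρ p) (val ρ y)
    ⊨divides p y = ⊨or (⊨one p) (⊨neg (⊨prec y p))

    ⊨bitAt : ∀ {m} {ρ : Fin m → Fin (suc n)} a p → ρ ⊨ bitAtF a p ⇔ BitAt (val ρ a) (val ρ p)
    ⊨bitAt {ρ = ρ} a p = ⇔-trans
      (⊨and (⊨power p) (⊨ex λ _ →
        ⊨and (⊨neg (⊨lt (suc a) zero)) (⊨and (⊨neg (⊨zero zero)) (⊨and (⊨divides (suc p) zero) (⊨and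
          (⊨all λ _ → ⊨imp (⊨and (⊨power zero) (⊨lt (suc (suc p)) zero)) (⊨prec (suc zero) zero))
          (⊨all λ _ → ⊨imp (⊨and (⊨lt (suc zero) zero) (⊨neg (⊨lt (suc (suc a)) zero)))
                           (⊨neg (⊨divides (suc (suc p)) zero))))))))
      (bitAt-iff (val ρ a) (val ρ p) (val≤ ρ a))

  tagF : ∀ {m} → Fin m → Formula₂ m
  tagF t = and (neg (zeroF t)) (all (imp (oneF zero) (precF (suc t) zero)))

  taggedExpF successorF doubledF baseExpF expF bitF : ∀ {m} → Fin m → Fin m → Formula₂ m
  taggedExpF i p = ex (and (tagF zero) (and (powerF (suc p)) (and (ltF (suc i) (suc p))
    (all (imp (powerF zero) (iff (bitAtF (suc zero) zero)
                                 (or (bitAtF (suc (suc i)) zero) (eq zero (suc (suc p))))))))))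
  successorF i j = and (ltF i j) (neg (ex (and (ltF (suc i) zero) (ltF zero (suc j)))))
  doubledF p q = and (and (powerF p) (powerF q)) (and (ltF p q)
    (neg (ex (and (powerF zero) (and (ltF (suc p) zero) (ltF zero (suc q)))))))
  baseExpF i p = or (taggedExpF i p) (and (zeroF i) (oneF p))

  stepExpF : (∀ {m} → Fin m → Fin m → Formula₂ m) → ∀ {m} → Fin m → Fin m → Formula₂ m
  stepExpF R i q = ex (ex (and (R (suc zero) zero) (and (successorF (suc zero) (suc (suc i)))
                                                          (doubledF zero (suc (suc q))))))

  expF i p = or (baseExpF i p) (or (stepExpF baseExpF i p) (stepExpF (stepExpF baseExpF) i p))
  bitF a i = ex (and (expF (suc i) zero) (bitAtF (suc a) zero))

  module _ {n : ℕ} where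

    ⊨tag : ∀ {m} {ρ : Fin m → Fin (suc n)} t → ρ ⊨ tagF t ⇔ Tag (val ρ t)
    ⊨tag {ρ = ρ} t = ⇔-trans
      (⊨and (⊨neg (⊨zero t)) (⊨all λ _ → ⊨imp (⊨one zero) (⊨prec (suc t) zero)))
      (tag-iff (val≤ ρ t))

    ⊨taggedExp : ∀ {m} {ρ : Fin m → Fin (suc n)} i p →
                 ρ ⊨ taggedExpF i p ⇔ TaggedExp n (val ρ i) (val ρ p)
    ⊨taggedExp {ρ = ρ} i p = ⇔-trans
      (⊨ex λ _ → ⊨and (⊨tag zero) (⊨and (⊨power (suc p)) (⊨and (⊨lt (suc i) (suc p))
        (⊨all λ _ → ⊨imp (⊨power zero) (⊨iff (⊨bitAt (suc zero) zero)
          (⊨or (⊨bitAt (suc (suc i)) zero) (⊨eq zero (suc (suc p)))))))))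
      (taggedExp-iff (val ρ i) (val ρ p) (val≤ ρ i) (val≤ ρ p))

    ⊨successor : ∀ {m} {ρ : Fin m → Fin (suc n)} i j → ρ ⊨ successorF i j ⇔ Successor (val ρ i) (val ρ j)
    ⊨successor {ρ = ρ} i j = ⇔-trans
      (⊨and (⊨lt i j) (⊨neg (⊨ex λ _ → ⊨and (⊨lt (suc i) zero) (⊨lt zero (suc j)))))
      (successor-iff (val≤ ρ j))

    ⊨doubled : ∀ {m} {ρ : Fin m → Fin (suc n)} p q → ρ ⊨ doubledF p q ⇔ Doubled (val ρ p) (val ρ q)
    ⊨doubled {ρ = ρ} p q = ⇔-trans
      (⊨and (⊨and (⊨power p) (⊨power q)) (⊨and (⊨lt p q)
        (⊨neg (⊨ex λ _ → ⊨and (⊨power zero) (⊨and (⊨lt (suc p) zero) (⊨lt zero (suc q)))))))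
      (doubled-iff (val≤ ρ q))

    ⊨baseExp : ∀ {m} {ρ : Fin m → Fin (suc n)} i p → ρ ⊨ baseExpF i p ⇔ BaseExp n (val ρ i) (val ρ p)
    ⊨baseExp i p = ⊨or (⊨taggedExp i p) (⊨and (⊨zero i) (⊨one p))

    ⊨stepExp : {R : ∀ {m} → Fin m → Fin m → Formula₂ m} {P : ℕ → ℕ → Set} →
               (∀ {m} {ρ : Fin m → Fin (suc n)} i p → ρ ⊨ R i p ⇔ P (val ρ i) (val ρ p)) →
               ∀ {m} {ρ : Fin m → Fin (suc n)} i q → ρ ⊨ stepExpF R i q ⇔ StepExp n P (val ρ i) (val ρ q)
    ⊨stepExp ⊨R i q = ⊨ex λ _ → ⊨ex λ _ →
      ⊨and (⊨R (suc zero) zero) (⊨and (⊨successor (suc zero) (suc (suc i))) (⊨doubled zero (suc (suc q))))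

    ⊨exp : ∀ {m} {ρ : Fin m → Fin (suc n)} i p → ρ ⊨ expF i p ⇔ (val ρ p ≡ 2 ^ val ρ i)
    ⊨exp {ρ = ρ} i p = ⇔-trans
      (⊨or (⊨baseExp i p) (⊨or (⊨stepExp {baseExpF} ⊨baseExp i p)
        (⊨stepExp {stepExpF baseExpF} (⊨stepExp {baseExpF} ⊨baseExp) i p)))
      (exp-iff (val ρ i) (val ρ p) (val≤ ρ i) (val≤ ρ p))

    ⊨bit : ∀ {m} {ρ : Fin m → Fin (suc n)} a i → ρ ⊨ bitF a i ⇔ Bit (val ρ a) (val ρ i)
    ⊨bit {ρ = ρ} a i = ⇔-trans
      (⊨ex λ _ → ⊨and (⊨exp (suc i) zero) (⊨bitAt (suc a) zero))
      (bit-iff (val ρ a) (val ρ i) (val≤ ρ a))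

  bitInterpretation : Interpretation (2 ∷ []) (2 ∷ 2 ∷ [])
  bitInterpretation zero (a ∷ i ∷ []) = bitF a i

  bitInterpretation-defines :
    Defines {2 ∷ []} {2 ∷ 2 ∷ []} BitOnly (LtPrec _≺_) bitInterpretation
  bitInterpretation-defines ρ zero (a ∷ i ∷ []) = ⇔-trans (⇔-sym (⊨bit a i)) ⊨⇔Sat

  BitOnly≤LtPrec : AtMostAsExpressive {2 ∷ []} {2 ∷ 2 ∷ []} BitOnly (LtPrec _≺_)
  BitOnly≤LtPrec = Translation.definable⇒AtMostAsExpressive {2 ∷ []} {2 ∷ 2 ∷ []}
    BitOnly (LtPrec _≺_) bitInterpretation bitInterpretation-defines

-- < and ≺ from Bit

Lift : ℕ → (ℕ → ℕ → Set) → ℕ → ℕ → Set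
Lift n R a b = ∃ λ j → j ≤ n × (Bit b j × (¬ Bit a j × (∀ i → i ≤ n → R j i → Bit a i ⇔ Bit b i)))

-- Bits of numbers in [n] sit at positions in [n], so bounding the quantifiers loses nothing. At a
-- position where neither number has a bit the required agreement is automatic; so `R` has to be
-- right only from bits of b to bits of a or b, which permits recursion on smaller numbers.
lift-iff : ∀ {n a b} (R : ℕ → ℕ → Set) → a ≤ n → b ≤ n →
  (∀ j i → j ≤ n → i ≤ n → Bit b j → Bit a i ⊎ Bit b i → R j i ⇔ j < i) →
  Lift n R a b ⇔ a < b
lift-iff {n} {a} {b} R a≤n b≤n correct = mk⇔ forth back
  where
  a-bit≤n : ∀ i → Bit a i → i ≤ n
  a-bit≤n i ai = ≤-trans (<⇒≤ (Bit⇒< a i ai)) a≤n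
  b-bit≤n : ∀ i → Bit b i → i ≤ n
  b-bit≤n i bi = ≤-trans (<⇒≤ (Bit⇒< b i bi)) b≤n
  forth : Lift n R a b → a < b
  forth (j , j≤n , bj , aj , h) = from <⇔top-difference (j , bj , aj , λ i j<i → mk⇔
    (λ ai → to (h i (a-bit≤n i ai) (from (correct j i j≤n (a-bit≤n i ai) bj (inj₁ ai)) j<i)) ai)
    (λ bi → from (h i (b-bit≤n i bi) (from (correct j i j≤n (b-bit≤n i bi) bj (inj₂ bi)) j<i)) bi))
  back : a < b → Lift n R a b
  back a<b with to <⇔top-difference a<b
  ... | j , bj , aj , h = j , b-bit≤n j bj , bj , aj , λ i i≤n r → mk⇔
    (λ ai → to (h i (to (correct j i (b-bit≤n j bj) i≤n bj (inj₁ ai)) r)) ai)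
    (λ bi → from (h i (to (correct j i (b-bit≤n j bj) i≤n bj (inj₂ bi)) r)) bi)

-- A number c is read as a set of sets: Field is its union, and a is Below b if some
-- member of c contains a but not b.
Field : ℕ → ℕ → ℕ → Set
Field n c a = ∃ λ s → s ≤ n × (Bit c s × Bit s a)

Below : ℕ → ℕ → ℕ → ℕ → Set
Below n c a b = ∃ λ s → s ≤ n × (Bit c s × (Bit s a × ¬ Bit s b))

-- Bit a i implies i < a, so on a transitive field the fixed point equation of Lift
-- determines Below by recursion: it must be <.
LiftFixedPoint : ℕ → ℕ → Set
LiftFixedPoint n c =
  (∀ a → a ≤ n → ∀ i → i ≤ n → Field n c a × Bit a i → Field n c i) ×
  (∀ a → a ≤ n → ∀ b → b ≤ n → Field n c a × Field n c b →
    Below n c a b ⇔ Lift n (Below n c) a b)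

Below⇔< : ∀ {n c} → LiftFixedPoint n c → ∀ k {a b} → a < k → b < k → a ≤ n → b ≤ n →
          Field n c a → Field n c b → Below n c a b ⇔ a < b
Below⇔< _ zero ()
Below⇔< {n} {c} fp@(transitive , step) (suc k) {a} {b} (s≤s a≤k) (s≤s b≤k) a≤n b≤n fa fb =
  ⇔-trans (step a a≤n b b≤n (fa , fb)) (lift-iff (Below n c) a≤n b≤n λ j i j≤n i≤n bj ab →
    Below⇔< fp k (<-≤-trans (Bit⇒< b j bj) b≤k) (bounded i ab) j≤n i≤n
      (transitive b b≤n j j≤n (fb , bj)) (inField i i≤n ab))
  where
  bounded : ∀ i → Bit a i ⊎ Bit b i → i < k
  bounded i (inj₁ ai) = <-≤-trans (Bit⇒< a i ai) a≤k
  bounded i (inj₂ bi) = <-≤-trans (Bit⇒< b i bi) b≤k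
  inField : ∀ i → i ≤ n → Bit a i ⊎ Bit b i → Field n c i
  inField i i≤n (inj₁ ai) = transitive a a≤n i i≤n (fa , ai)
  inField i i≤n (inj₂ bi) = transitive b b≤n i i≤n (fb , bi)

-- Codes made of initial segments

abstract

  segment : ℕ → ℕ
  segment b = fromBits (_<? b) b

  Bit-segment : ∀ b a → Bit (segment b) a ⇔ a < b
  Bit-segment b a = ⇔-trans (Bit-fromBits (_<? b) b a) (mk⇔ proj₁ λ lt → lt , lt)

  segment<2^ : ∀ b → segment b < 2 ^ b
  segment<2^ b = fromBits< (_<? b) b

IsSegment : ℕ → ℕ → Set
IsSegment M s = ∃ λ b → b < suc M × s ≡ segment b

IsSegment? : ∀ M s → Dec (IsSegment M s)
IsSegment? M s = anyUpTo? (λ b → s ≟ segment b) (suc M)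

abstract

  -- The segment of length b is 2^b - 1, so every member is below 2^M. The members run up to length
  -- M inclusive, so that the field is exactly the numbers below M.
  segments : ℕ → ℕ
  segments M = fromBits (IsSegment? M) (2 ^ M)

  Bit-segments : ∀ M s → Bit (segments M) s ⇔ IsSegment M s
  Bit-segments M s = ⇔-trans (Bit-fromBits (IsSegment? M) (2 ^ M) s) (mk⇔ proj₂ λ where
    (b , b≤M , refl) → <-≤-trans (segment<2^ b) (2^-mono-≤ (s≤s⁻¹ b≤M)) , b , b≤M , refl)

  segments<2^2^ : ∀ M → segments M < 2 ^ (2 ^ M)
  segments<2^2^ M = fromBits< (IsSegment? M) (2 ^ M)

module _ {n M : ℕ} (c≤n : segments M ≤ n) where

  segment-visible : ∀ {b} → b ≤ M → segment b ≤ n × Bit (segments M) (segment b)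
  segment-visible {b} b≤M = ≤-trans (<⇒≤ (Bit⇒< (segments M) (segment b) bit)) c≤n , bit
    where
    bit : Bit (segments M) (segment b)
    bit = from (Bit-segments M (segment b)) (b , s≤s b≤M , refl)

  Field-segments : ∀ a → Field n (segments M) a ⇔ a < M
  Field-segments a = mk⇔ forth λ a<M →
      let le , bit = segment-visible ≤-refl in segment M , le , bit , from (Bit-segment M a) a<M
    where
    forth : Field n (segments M) a → a < M
    forth (s , _ , cs , sa) with to (Bit-segments M s) cs
    ... | b , b≤M , refl = <-≤-trans (to (Bit-segment b a) sa) (s≤s⁻¹ b≤M)

  Below-segments : ∀ {a} b → a < M → Below n (segments M) a b ⇔ a < b
  Below-segments {a} b a<M = mk⇔ forth λ a<b →
      let le , bit = segment-visible a<M in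
      -- The shortest segment containing a; it belongs to the code because `a<M` means suc a ≤ M.
      segment (suc a) , le , bit , from (Bit-segment (suc a) a) (n<1+n a) ,
      λ sb → <⇒≱ a<b (s≤s⁻¹ (to (Bit-segment (suc a) b) sb))
    where
    forth : Below n (segments M) a b → a < b
    forth (s , _ , cs , sa , sb) with to (Bit-segments M s) cs
    ... | b′ , _ , refl = <-≤-trans (to (Bit-segment b′ a) sa) (≮⇒≥ (sb ∘ from (Bit-segment b′ b)))

  segments-fixed-point : LiftFixedPoint n (segments M)
  segments-fixed-point =
    (λ a _ i _ (fa , ai) → from (Field-segments i) (<-trans (Bit⇒< a i ai) (to (Field-segments a) fa))) ,
    (λ a a≤n b b≤n (fa , fb) →
      ⇔-trans (Below-segments b (to (Field-segments a) fa))
        (⇔-sym (lift-iff (Below n (segments M)) a≤n b≤n λ j i _ _ bj _ →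
          Below-segments i (<-trans (Bit⇒< b j bj) (to (Field-segments b) fb)))))

-- From a coded order to `<` on all of [n]

LtBase : ℕ → ℕ → ℕ → Set
LtBase n a b = ∃ λ c → c ≤ n × (LiftFixedPoint n c × (Field n c a × (Field n c b × Below n c a b)))

-- Every fixed point agrees with `<` on its field, whether or not it is some `segments M`; so
-- guessing the code existentially is sound, and `segments` matters only for existence.
LtBase⇒< : ∀ {n a b} → a ≤ n → b ≤ n → LtBase n a b → a < b
LtBase⇒< {a = a} {b} a≤n b≤n (_ , _ , fp , fa , fb , below) =
  to (Below⇔< fp (suc (a + b)) (s≤s (m≤m+n a b)) (s≤s (m≤n+m b a)) a≤n b≤n fa fb) below

CorrectBelow : ℕ → ℕ → (ℕ → ℕ → Set) → Set
CorrectBelow n M R = ∀ {a b} → a ≤ n → b ≤ n → a < M → b < M → R a b ⇔ a < b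

LtBase-correct : ∀ {n M} → segments M ≤ n → CorrectBelow n M (LtBase n)
LtBase-correct {M = M} c≤n {a} {b} a≤n b≤n a<M b<M = mk⇔ (LtBase⇒< a≤n b≤n) λ a<b →
  segments M , c≤n , segments-fixed-point c≤n , from (Field-segments c≤n a) a<M ,
  from (Field-segments c≤n b) b<M , from (Below-segments c≤n b a<M) a<b

-- Numbers below 2^M have all their bits at positions below M, where `R` is already correct.
Lift-correct : ∀ {n M R} → CorrectBelow n M R → CorrectBelow n (2 ^ M) (Lift n R)
Lift-correct {n} {M} {R} correct {a} {b} a≤n b≤n a< b< = lift-iff R a≤n b≤n
  λ j i j≤n i≤n bj ab → correct j≤n i≤n (bit<M b< bj) ([ bit<M a< , bit<M b< ]′ ab)
  where
  bit<M : ∀ {x j} → x < 2 ^ M → Bit x j → j < M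
  bit<M {x} {j} x< xj = 2^-cancel-< {j} {M} (≤-<-trans (Bit⇒2^≤ x j xj) x<)

bracket : (f : ℕ → ℕ) → ∀ k {x} → x < f k → x < f 0 ⊎ ∃ λ M → f M ≤ x × x < f (suc M)
bracket f zero    lt = inj₁ lt
bracket f (suc k) {x} lt with x <? f k
... | yes lt′ = bracket f k lt′
... | no x≮   = inj₂ (k , ≮⇒≥ x≮ , lt)

-- Bracketing n + 1 rather than n turns the strict bound on `segments M` into `segments M ≤ n`. The
-- upper bound follows from M + 1 ≤ 2^M.
base-range : ∀ n → ∃ λ M → CorrectBelow n M (LtBase n) × n < 2 ^ 2 ^ 2 ^ M
base-range n with bracket (λ M → 2 ^ 2 ^ M) (suc n) (<-trans (n<2^n (suc n)) (2^-mono-< (n<2^n (suc n))))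
-- Here n = 0, and correctness below 0 is vacuous.
... | inj₁ (s≤s n<1) = 0 , (λ _ _ ()) , ≤-trans n<1 (s≤s z≤n)
... | inj₂ (M , lower , upper) =
  M , LtBase-correct (s≤s⁻¹ (<-≤-trans (segments<2^2^ M) lower)) ,
  <-≤-trans (<-trans (n<1+n n) upper) (2^-mono-≤ (2^-mono-≤ (n<2^n M)))

Lift³-LtBase⇔< : ∀ {n a b} → a ≤ n → b ≤ n → Lift n (Lift n (Lift n (LtBase n))) a b ⇔ a < b
Lift³-LtBase⇔< {n} a≤n b≤n with base-range n
... | M , correct , n< = Lift-correct (Lift-correct (Lift-correct correct)) a≤n b≤n
                           (≤-<-trans a≤n n<) (≤-<-trans b≤n n<)

-- Tags and keys in terms of bits

empty-bits-iff : ∀ {n x} → x ≤ n → (∀ k → k ≤ n → ¬ Bit x k) ⇔ x ≡ 0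
empty-bits-iff {n} {x} x≤n = mk⇔
  (λ h → Bit-extensional λ i → mk⇔
    (λ xi → ⊥-elim (h i (≤-trans (<⇒≤ (Bit⇒< x i xi)) x≤n) xi))
    (λ 0i → ⊥-elim (n≮0 (Bit⇒< 0 i 0i))))
  λ { refl k _ b → n≮0 (Bit⇒< 0 k b) }

adjoin-iff : ∀ {n x} → x ≤ n →
  (∃ λ i → i ≤ n × (Bit i 0 × (∀ j → j ≤ n → Bit x j ⇔ (Bit i j ⊎ j ≡ i)))) ⇔ Tag x
adjoin-iff {n} {x} x≤n = mk⇔ forth λ { (i , i<x , odd , refl) →
    i , ≤-trans (<⇒≤ i<x) x≤n , odd , λ j _ → Bit-adjoin i j }
  where
  forth : (∃ λ i → i ≤ n × (Bit i 0 × (∀ j → j ≤ n → Bit x j ⇔ (Bit i j ⊎ j ≡ i)))) → Tag x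
  forth (i , i≤n , odd , h) = subst Tag (sym x≡) (tag odd)
    where
    bounded : ∀ j → Bit i j ⊎ j ≡ i → j ≤ n
    bounded j (inj₁ ij)   = ≤-trans (<⇒≤ (Bit⇒< i j ij)) i≤n
    bounded j (inj₂ refl) = i≤n
    x≡ : x ≡ adjoin i
    x≡ = Bit-extensional λ j → mk⇔
      (λ xj → from (Bit-adjoin i j) (to (h j (≤-trans (<⇒≤ (Bit⇒< x j xj)) x≤n)) xj))
      (λ ij → let m = to (Bit-adjoin i j) ij in from (h j (bounded j m)) m)

KeyLess : ℕ → ℕ → ℕ → Set
KeyLess n x y = (Low x × ¬ Low y) ⊎ ((¬ Low x × ¬ Low y) ×
  ∃ λ i → i ≤ n × (Bit x i × (∀ j → j ≤ n → ¬ i < j → ¬ Bit y j)))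

-- Away from low numbers the exponent of 2 is the position of the lowest set bit. Any set bit i of x
-- will do as a witness: it gives key x ≤ i + 1, and the absence of bits of y up to i gives i + 1 <
-- key y.
keyLess-iff : ∀ {n} x y → x ≤ n → KeyLess n x y ⇔ key x < key y
keyLess-iff {n} x y x≤n = mk⇔ forth back
  where
  forth : KeyLess n x y → key x < key y
  forth (inj₁ (lx , ny)) = subst (_< key y) (sym (Low⇒key≡0 lx)) (from (<key⇔2^∣ ny 0) (1∣ y))
  forth (inj₂ ((nx , ny) , i , i≤n , xi , h)) = ≤-<-trans
    (≮⇒≥ λ lt → to (2^∣⇔no-low-bits (suc i) x) (to (<key⇔2^∣ nx (suc i)) lt) i (n<1+n i) xi)
    (from (<key⇔2^∣ ny (suc i)) (from (2^∣⇔no-low-bits (suc i) y)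
      λ j j≤i → h j (≤-trans (s≤s⁻¹ j≤i) i≤n) (≤⇒≯ (s≤s⁻¹ j≤i))))
  back : key x < key y → KeyLess n x y
  back lt with toSum (Low? y)
  ... | inj₁ ly = ⊥-elim (n≮0 (subst (key x <_) (Low⇒key≡0 ly) lt))
  ... | inj₂ ny with toSum (Low? x)
  ...   | inj₁ lx = inj₁ (lx , ny)
  ...   | inj₂ nx with anyUpTo? (Bit? x) (key x)
  ...     | yes (i , i<key , xi) = inj₂ ((nx , ny) , i , ≤-trans (<⇒≤ (Bit⇒< x i xi)) x≤n , xi ,
              λ j _ j≤i → to (2^∣⇔no-low-bits (key x) y) (to (<key⇔2^∣ ny (key x)) lt) j
                (≤-<-trans (≮⇒≥ j≤i) i<key))
  ...     | no none = ⊥-elim (<-irrefl refl (from (<key⇔2^∣ nx (key x))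
              (from (2^∣⇔no-low-bits (key x) x) λ i i<key xi → none (i , i<key , xi))))

-- Equality of keys is replaced by a negated comparison, so that one formula for comparing keys is
-- enough.
≺-iff : ∀ x y → (key x < key y ⊎ (¬ key y < key x × x < y)) ⇔ x ≺ y
≺-iff x y = mk⇔ forth λ where
    (inj₁ lt)       → inj₁ lt
    (inj₂ (e , lt)) → inj₂ (<-irrefl (sym e) , lt)
  where
  forth : key x < key y ⊎ (¬ key y < key x × x < y) → x ≺ y
  forth (inj₁ lt) = inj₁ lt
  forth (inj₂ (≮ , lt)) with <-cmp (key x) (key y)
  ... | tri< p _ _ = inj₁ p
  ... | tri≈ _ e _ = inj₂ (e , lt)
  ... | tri> _ _ p = ⊥-elim (≮ p)

-- Formulas in `Bit`

module FromBit where

  BitOnly? : ∀ j v → Dec (BitOnly j v)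
  BitOnly? zero (a ∷ i ∷ []) = Bit? a i

  open Semantics BitOnly BitOnly?

  Formula₁ : ℕ → Set
  Formula₁ = Formula [] (2 ∷ [])

  bitF : ∀ {m} → Fin m → Fin m → Formula₁ m
  bitF a i = bip zero (a ∷ i ∷ [])

  zeroF oddF tagF lowF : ∀ {m} → Fin m → Formula₁ m
  zeroF x = all (neg (bitF (suc x) zero))
  oddF x  = all (imp (zeroF zero) (bitF (suc x) zero))
  tagF x  = ex (and (oddF zero)
    (all (iff (bitF (suc (suc x)) zero) (or (bitF (suc zero) zero) (eq zero (suc zero))))))
  lowF x  = or (zeroF x) (tagF x)

  -- The parameter `c` carries the code on which `belowF` depends through the two binders; `ltBaseF`
  -- quantifies its own code.
  liftF : (∀ {m} → Fin m → Fin m → Fin m → Formula₁ m) → ∀ {m} → Fin m → Fin m → Fin m → Formula₁ m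
  liftF R c a b = ex (and (bitF (suc b) zero) (and (neg (bitF (suc a) zero))
    (all (imp (R (suc (suc c)) (suc zero) zero)
              (iff (bitF (suc (suc a)) zero) (bitF (suc (suc b)) zero))))))

  fieldF : ∀ {m} → Fin m → Fin m → Formula₁ m
  fieldF c a = ex (and (bitF (suc c) zero) (bitF zero (suc a)))

  belowF : ∀ {m} → Fin m → Fin m → Fin m → Formula₁ m
  belowF c a b = ex (and (bitF (suc c) zero) (and (bitF zero (suc a)) (neg (bitF zero (suc b)))))

  fixedPointF : ∀ {m} → Fin m → Formula₁ m
  fixedPointF c = and
    (all (all (imp (and (fieldF (suc (suc c)) (suc zero)) (bitF (suc zero) zero))
                   (fieldF (suc (suc c)) zero))))
    (all (all (imp (and (fieldF (suc (suc c)) (suc zero)) (fieldF (suc (suc c)) zero))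
                   (iff (belowF (suc (suc c)) (suc zero) zero)
                        (liftF belowF (suc (suc c)) (suc zero) zero)))))

  ltBaseF : ∀ {m} → Fin m → Fin m → Fin m → Formula₁ m
  ltBaseF _ a b = ex (and (fixedPointF zero) (and (fieldF zero (suc a))
    (and (fieldF zero (suc b)) (belowF zero (suc a) (suc b)))))

  ltF keyLessF precF : ∀ {m} → Fin m → Fin m → Formula₁ m
  ltF a b = liftF (liftF (liftF ltBaseF)) a a b
  keyLessF x y = or (and (lowF x) (neg (lowF y))) (and (and (neg (lowF x)) (neg (lowF y)))
    (ex (and (bitF (suc x) zero)
             (all (imp (neg (ltF (suc zero) zero)) (neg (bitF (suc (suc y)) zero)))))))
  precF x y = or (keyLessF x y) (and (neg (keyLessF y x)) (ltF x y))

  module _ {n : ℕ} where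

    ⊨bit : ∀ {m} {ρ : Fin m → Fin (suc n)} a i → ρ ⊨ bitF a i ⇔ Bit (val ρ a) (val ρ i)
    ⊨bit a i = ⊨bip zero _

    ⊨zero : ∀ {m} {ρ : Fin m → Fin (suc n)} x → ρ ⊨ zeroF x ⇔ val ρ x ≡ 0
    ⊨zero {ρ = ρ} x = ⇔-trans (⊨all λ _ → ⊨neg (⊨bit (suc x) zero)) (empty-bits-iff (val≤ ρ x))

    ⊨odd : ∀ {m} {ρ : Fin m → Fin (suc n)} x → ρ ⊨ oddF x ⇔ Bit (val ρ x) 0
    ⊨odd {ρ = ρ} x = ⇔-trans
      (⊨all {P = λ k → k ≡ 0 → Bit (val ρ x) k} λ _ → ⊨imp (⊨zero zero) (⊨bit (suc x) zero))
      (mk⇔ (λ h → h 0 z≤n refl) λ { b _ _ refl → b })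

    ⊨tag : ∀ {m} {ρ : Fin m → Fin (suc n)} x → ρ ⊨ tagF x ⇔ Tag (val ρ x)
    ⊨tag {ρ = ρ} x = ⇔-trans
      (⊨ex λ _ → ⊨and (⊨odd zero) (⊨all λ _ → ⊨iff (⊨bit (suc (suc x)) zero)
        (⊨or (⊨bit (suc zero) zero) (⊨eq zero (suc zero)))))
      (adjoin-iff (val≤ ρ x))

    ⊨low : ∀ {m} {ρ : Fin m → Fin (suc n)} x → ρ ⊨ lowF x ⇔ Low (val ρ x)
    ⊨low x = ⊨or (⊨zero x) (⊨tag x)

    ⊨lift : (R : ∀ {m} → Fin m → Fin m → Fin m → Formula₁ m) (P : ℕ → ℕ → ℕ → Set) →
            (∀ {m} {ρ : Fin m → Fin (suc n)} c a b → ρ ⊨ R c a b ⇔ P (val ρ c) (val ρ a) (val ρ b)) →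
            ∀ {m} {ρ : Fin m → Fin (suc n)} c a b →
            ρ ⊨ liftF R c a b ⇔ Lift n (P (val ρ c)) (val ρ a) (val ρ b)
    ⊨lift R P ⊨R c a b = ⊨ex λ _ → ⊨and (⊨bit (suc b) zero) (⊨and (⊨neg (⊨bit (suc a) zero))
      (⊨all λ _ → ⊨imp (⊨R (suc (suc c)) (suc zero) zero)
                       (⊨iff (⊨bit (suc (suc a)) zero) (⊨bit (suc (suc b)) zero))))

    ⊨field : ∀ {m} {ρ : Fin m → Fin (suc n)} c a → ρ ⊨ fieldF c a ⇔ Field n (val ρ c) (val ρ a)
    ⊨field c a = ⊨ex λ _ → ⊨and (⊨bit (suc c) zero) (⊨bit zero (suc a))

    ⊨below : ∀ {m} {ρ : Fin m → Fin (suc n)} c a b →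
             ρ ⊨ belowF c a b ⇔ Below n (val ρ c) (val ρ a) (val ρ b)
    ⊨below c a b = ⊨ex λ _ →
      ⊨and (⊨bit (suc c) zero) (⊨and (⊨bit zero (suc a)) (⊨neg (⊨bit zero (suc b))))

    ⊨fixedPoint : ∀ {m} {ρ : Fin m → Fin (suc n)} c → ρ ⊨ fixedPointF c ⇔ LiftFixedPoint n (val ρ c)
    ⊨fixedPoint c = ⊨and
      (⊨all λ _ → ⊨all λ _ → ⊨imp (⊨and (⊨field (suc (suc c)) (suc zero)) (⊨bit (suc zero) zero))
                                   (⊨field (suc (suc c)) zero))
      (⊨all λ _ → ⊨all λ _ → ⊨imp (⊨and (⊨field (suc (suc c)) (suc zero)) (⊨field (suc (suc c)) zero))
        (⊨iff (⊨below (suc (suc c)) (suc zero) zero)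
              (⊨lift belowF (Below n) ⊨below (suc (suc c)) (suc zero) zero)))

    ⊨ltBase : ∀ {m} {ρ : Fin m → Fin (suc n)} c a b → ρ ⊨ ltBaseF c a b ⇔ LtBase n (val ρ a) (val ρ b)
    ⊨ltBase _ a b = ⊨ex λ _ → ⊨and (⊨fixedPoint zero) (⊨and (⊨field zero (suc a))
      (⊨and (⊨field zero (suc b)) (⊨below zero (suc a) (suc b))))

    ⊨lt : ∀ {m} {ρ : Fin m → Fin (suc n)} a b → ρ ⊨ ltF a b ⇔ val ρ a < val ρ b
    ⊨lt {ρ = ρ} a b = ⇔-trans
      (⊨lift (liftF (liftF ltBaseF)) (λ _ → Lift n (Lift n (LtBase n)))
        (⊨lift (liftF ltBaseF) (λ _ → Lift n (LtBase n))
          (⊨lift ltBaseF (λ _ → LtBase n) ⊨ltBase)) a a b)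
      (Lift³-LtBase⇔< (val≤ ρ a) (val≤ ρ b))

    ⊨keyLess : ∀ {m} {ρ : Fin m → Fin (suc n)} x y → ρ ⊨ keyLessF x y ⇔ key (val ρ x) < key (val ρ y)
    ⊨keyLess {ρ = ρ} x y = ⇔-trans
      (⊨or (⊨and (⊨low x) (⊨neg (⊨low y))) (⊨and (⊨and (⊨neg (⊨low x)) (⊨neg (⊨low y)))
        (⊨ex λ _ → ⊨and (⊨bit (suc x) zero)
          (⊨all λ _ → ⊨imp (⊨neg (⊨lt (suc zero) zero)) (⊨neg (⊨bit (suc (suc y)) zero))))))
      (keyLess-iff (val ρ x) (val ρ y) (val≤ ρ x))

    ⊨prec : ∀ {m} {ρ : Fin m → Fin (suc n)} x y → ρ ⊨ precF x y ⇔ val ρ x ≺ val ρ y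
    ⊨prec {ρ = ρ} x y = ⇔-trans
      (⊨or (⊨keyLess x y) (⊨and (⊨neg (⊨keyLess y x)) (⊨lt x y)))
      (≺-iff (val ρ x) (val ρ y))

  ordersInterpretation : Interpretation (2 ∷ 2 ∷ []) (2 ∷ [])
  ordersInterpretation zero       (a ∷ b ∷ []) = ltF a b
  ordersInterpretation (suc zero) (a ∷ b ∷ []) = precF a b

  ordersInterpretation-defines :
    Defines {2 ∷ 2 ∷ []} {2 ∷ []} (LtPrec _≺_) BitOnly ordersInterpretation
  ordersInterpretation-defines ρ zero       (a ∷ b ∷ []) = ⇔-trans (⇔-sym (⊨lt a b)) ⊨⇔Sat
  ordersInterpretation-defines ρ (suc zero) (a ∷ b ∷ []) = ⇔-trans (⇔-sym (⊨prec a b)) ⊨⇔Sat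

  LtPrec≤BitOnly : AtMostAsExpressive {2 ∷ 2 ∷ []} {2 ∷ []} (LtPrec _≺_) BitOnly
  LtPrec≤BitOnly = Translation.definable⇒AtMostAsExpressive {2 ∷ 2 ∷ []} {2 ∷ []}
    (LtPrec _≺_) BitOnly ordersInterpretation ordersInterpretation-defines

theorem5p2 : Σ (ℕ → ℕ → Set) λ _≺_ →
    IsStrictTotalOrder _≡_ _≺_ × SameExpressivePower (LtPrec _≺_) BitOnly
theorem5p2 = _≺_ , ≺-isStrictTotalOrder , FromBit.LtPrec≤BitOnly , FromOrders.BitOnly≤LtPrec
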